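{- Let $G$ be a $\mathscr C_1^{(4)}$-hom-free $4$-graph on $n\ge1$ vertices. Then $e(G)<n^4/48$.
   Context: A $4$-graph is a $4$-uniform hypergraph; $e(G)$ is its number of edges. For $\ell>4$, the tight cycle $C_\ell^{(4)}$ has vertices $v_1,\dots,v_\ell$ and edges $\{v_i,v_{i+1},v_{i+2},v_{i+3}\}$, $1\le i\le\ell$ (indices mod $\ell$). A homomorphism $F\to G$ is a map $V(F)\to V(G)$ sending each edge of $F$ onto an edge of $G$. $G$ is $\mathscr C_1^{(4)}$-hom-free if there is no homomorphism $C_\ell^{(4)}\to G$ for any $\ell>4$ with $\ell\equiv1\pmod4$. -}

module Defs where

open import Data.Bool.Properties using () renaming (_≟_ to _≟ᵇ_)
open import Data.Fin using (Fin; zero; suc; toℕ)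
open import Data.Fin.Properties using (toℕ-fromℕ<)
open import Data.Fin.Subset using (Subset; inside; outside; ⁅_⁆; _∪_; ∣_∣; _∈_; _∉_)
open import Data.Fin.Subset.Properties using (∪-identityˡ; ∣⁅x⁆∣≡1; x∈⁅y⁆⇒x≡y; x∈p∪q⁻)
open import Data.List using (List; length; map; allFin; deduplicate)
import Data.List.Membership.Propositional as List
open import Data.List.Membership.Propositional.Properties using (∈-map⁻; ∈-deduplicate⁻)
open import Data.List.Relation.Unary.All using (All; tabulate)
open import Data.List.Relation.Unary.Unique.Propositional using (Unique)
import Data.List.Relation.Unary.Unique.DecPropositional.Properties as Unique
open import Data.Nat using (ℕ; zero; suc; _+_; _*_; _≤_; _<_; z≤n; s≤s; z<s; NonZero; >-nonZero)
open import Data.Nat.DivMod using (_%_; _/_; _mod_; m≡m%n+[m/n]*n; m%n<n)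
open import Data.Nat.Divisibility using (_∣_; divides-refl; ∣m+n∣m⇒∣n; >⇒∤)
open import Data.Nat.Properties using (≤-<-trans; <-≤-trans; +-assoc; +-cancelˡ-≡)
open import Data.Product using (_×_; _,_; ∃; ∃-syntax)
open import Data.Sum using (inj₁; inj₂)
open import Data.Vec using (_∷_; here; there)
open import Data.Vec.Properties using (≡-dec)
open import Function using (_∘_; _⇔_)
open import Relation.Binary.Definitions using (DecidableEquality)
open import Relation.Binary.PropositionalEquality
open import Relation.Nullary using (¬_; contradiction)

-- A k-uniform hypergraph on the vertex set Fin n.  The edge set is listed
-- without repetition, so its cardinality is the length of the list.
record UniformHypergraph (k n : ℕ) : Set where
  field
    edges   : List (Subset n)
    unique  : Unique edges
    uniform : All (λ p → ∣ p ∣ ≡ k) edges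

  e : ℕ
  e = length edges

  IsEdge : Subset n → Set
  IsEdge p = p List.∈ edges

open UniformHypergraph public using (e; IsEdge)

4-Graph : ℕ → Set
4-Graph = UniformHypergraph 4

MapsOnto : ∀ {m n} → (Fin m → Fin n) → Subset m → Subset n → Set
MapsOnto f p q = ∀ y → y ∈ q ⇔ (∃[ x ] x ∈ p × f x ≡ y)

IsHomomorphism : ∀ {k m n} → UniformHypergraph k m → UniformHypergraph k n →
                 (Fin m → Fin n) → Set
IsHomomorphism F G f = ∀ p → IsEdge F p → ∃[ q ] IsEdge G q × MapsOnto f p q

Homomorphism : ∀ {k m n} → UniformHypergraph k m → UniformHypergraph k n → Set
Homomorphism F G = ∃ (IsHomomorphism F G)

module _ {ℓ : ℕ} .{{_ : NonZero ℓ}} where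

  shift : Fin ℓ → ℕ → Fin ℓ
  shift i a = (toℕ i + a) mod ℓ

  window : Fin ℓ → Subset ℓ
  window i = ⁅ shift i 0 ⁆ ∪ (⁅ shift i 1 ⁆ ∪ (⁅ shift i 2 ⁆ ∪ ⁅ shift i 3 ⁆))

  private
    %-shift-≢ : ∀ m {d} → 0 < d → d < ℓ → m % ℓ ≢ (m + d) % ℓ
    %-shift-≢ m {suc d} _ d<ℓ eq = >⇒∤ d<ℓ (∣m+n∣m⇒∣n ℓ∣sum (divides-refl (m / ℓ)))
      where
      open ≡-Reasoning
      sum≡ : m / ℓ * ℓ + suc d ≡ (m + suc d) / ℓ * ℓ
      sum≡ = +-cancelˡ-≡ (m % ℓ) _ _ (begin
        m % ℓ + (m / ℓ * ℓ + suc d)                 ≡⟨ +-assoc (m % ℓ) _ _ ⟨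
        m % ℓ + m / ℓ * ℓ + suc d                   ≡⟨ cong (_+ suc d) (m≡m%n+[m/n]*n m ℓ) ⟨
        m + suc d                                   ≡⟨ m≡m%n+[m/n]*n (m + suc d) ℓ ⟩
        (m + suc d) % ℓ + (m + suc d) / ℓ * ℓ       ≡⟨ cong (_+ (m + suc d) / ℓ * ℓ) eq ⟨
        m % ℓ + (m + suc d) / ℓ * ℓ                 ∎)
      ℓ∣sum : ℓ ∣ m / ℓ * ℓ + suc d
      ℓ∣sum = subst (ℓ ∣_) (sym sum≡) (divides-refl ((m + suc d) / ℓ))

    shift-≢ : ∀ i a {d} → 0 < d → d < ℓ → shift i a ≢ shift i (a + d)
    shift-≢ i a {d} 0<d d<ℓ eq = %-shift-≢ (toℕ i + a) 0<d d<ℓ (begin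
      (toℕ i + a) % ℓ          ≡⟨ toℕ-fromℕ< (m%n<n (toℕ i + a) ℓ) ⟨
      toℕ (shift i a)          ≡⟨ cong toℕ eq ⟩
      toℕ (shift i (a + d))    ≡⟨ toℕ-fromℕ< (m%n<n (toℕ i + (a + d)) ℓ) ⟩
      (toℕ i + (a + d)) % ℓ    ≡⟨ cong (_% ℓ) (+-assoc (toℕ i) a d) ⟨
      (toℕ i + a + d) % ℓ      ∎)
      where open ≡-Reasoning

    ∣⁅x⁆∪p∣ : ∀ {n} (x : Fin n) (p : Subset n) → x ∉ p → ∣ ⁅ x ⁆ ∪ p ∣ ≡ suc ∣ p ∣
    ∣⁅x⁆∪p∣ zero    (inside  ∷ p) x∉p = contradiction here x∉p
    ∣⁅x⁆∪p∣ zero    (outside ∷ p) x∉p = cong (suc ∘ ∣_∣) (∪-identityˡ p)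
    ∣⁅x⁆∪p∣ (suc x) (inside  ∷ p) x∉p = cong suc (∣⁅x⁆∪p∣ x p (x∉p ∘ there))
    ∣⁅x⁆∪p∣ (suc x) (outside ∷ p) x∉p = ∣⁅x⁆∪p∣ x p (x∉p ∘ there)

    ∉⁅⁆ : ∀ {n} {x y : Fin n} → x ≢ y → x ∉ ⁅ y ⁆
    ∉⁅⁆ {y = y} x≢y = x≢y ∘ x∈⁅y⁆⇒x≡y y

    ∉∪ : ∀ {n} {x : Fin n} {p q : Subset n} → x ∉ p → x ∉ q → x ∉ p ∪ q
    ∉∪ {p = p} {q} x∉p x∉q x∈ with x∈p∪q⁻ p q x∈
    ... | inj₁ x∈p = x∉p x∈p
    ... | inj₂ x∈q = x∉q x∈q

  ∣window∣≡4 : 4 < ℓ → ∀ i → ∣ window i ∣ ≡ 4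
  ∣window∣≡4 4<ℓ i =
    trans (∣⁅x⁆∪p∣ _ _ (∉∪ (∉⁅⁆ (≢ 0 1≤3)) (∉∪ (∉⁅⁆ (≢ 0 2≤3)) (∉⁅⁆ (≢ 0 3≤3)))))
    (cong suc (trans (∣⁅x⁆∪p∣ _ _ (∉∪ (∉⁅⁆ (≢ 1 1≤3)) (∉⁅⁆ (≢ 1 2≤3))))
    (cong suc (trans (∣⁅x⁆∪p∣ _ _ (∉⁅⁆ (≢ 2 1≤3)))
    (cong suc (∣⁅x⁆∣≡1 (shift i 3)))))))
    where
    1≤3 : 1 ≤ 3
    1≤3 = s≤s z≤n
    2≤3 : 2 ≤ 3
    2≤3 = s≤s (s≤s z≤n)
    3≤3 : 3 ≤ 3
    3≤3 = s≤s (s≤s (s≤s z≤n))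
    ≢ : ∀ a {d} → suc d ≤ 3 → shift i a ≢ shift i (a + suc d)
    ≢ a d≤3 = shift-≢ i a z<s (≤-<-trans d≤3 (<-≤-trans (s≤s (s≤s (s≤s (s≤s z≤n)))) 4<ℓ))

private
  _≟ˢ_ : ∀ {n} → DecidableEquality (Subset n)
  _≟ˢ_ = ≡-dec _≟ᵇ_

-- The windows of four cyclically consecutive vertices are pairwise distinct
-- for ℓ > 4; deduplicate only supplies the proof of uniqueness.
tightCycle : ∀ ℓ → 4 < ℓ → 4-Graph ℓ
tightCycle ℓ 4<ℓ = record
  { edges   = deduplicate _≟ˢ_ windows
  ; unique  = Unique.deduplicate-! _≟ˢ_ windows
  ; uniform = tabulate size
  }
  where
  instance
    ℓ≢0 : NonZero ℓ
    ℓ≢0 = >-nonZero (≤-<-trans z≤n 4<ℓ)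
  windows : List (Subset ℓ)
  windows = map window (allFin ℓ)
  size : ∀ {p} → p List.∈ deduplicate _≟ˢ_ windows → ∣ p ∣ ≡ 4
  size p∈ with ∈-map⁻ window (∈-deduplicate⁻ _≟ˢ_ windows p∈)
  ... | i , _ , refl = ∣window∣≡4 4<ℓ i

𝒞₁-HomFree : ∀ {n} → 4-Graph n → Set
𝒞₁-HomFree G = ∀ ℓ (4<ℓ : 4 < ℓ) → ℓ % 4 ≡ 1 → ¬ Homomorphism (tightCycle ℓ 4<ℓ) G

{-# OPTIONS --safe #-}
module Submission where

-- Tight steps abc → bcd have no odd closed walk: one of length m, traversed m + 4
-- times, would be a cycle of length ≡ 1 (mod 4).  Hence ordered triples have a
-- colouring that changes at every step.  Fix a vertex d.  The six colours of the
-- orderings of dab determine a label of the pair ab (red, blue, oriented or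
-- cyclic) such that every triple abc in the link of d is a red triangle, a blue
-- pair with arrows to it from the third vertex, or a cyclic triangle.  A triple
-- giving a red pair in the link of d gives an arrow in the links of its other two
-- vertices, so some d has at most as many ordered red pairs as arrows.  For such a
-- d the link has at most about m³/12 triples, m = n - 1, and deleting d gives the
-- theorem by induction.
--
-- Let r, b, o, c be the densities of the four kinds of pairs.  The link has density
-- at most r^(3/2) + (3/2) o √b + c/2, which is at most 1/2 if b ≤ r and 2r ≤ o, and
-- also if b = r.  If r < b, then some vertex a has at least as many incoming arrows
-- and blue pairs as outgoing arrows and red pairs, and its degree in the link is at
-- most m²/4; deleting such vertices one reaches b = r, up to a rounding error.

open import Defs
open import Data.Nat using (ℕ; _≥_; _^_)
open import Data.Integer using (+_)
open import Data.Rational.Unnormalised using (_/_; _<_)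

open import Data.Bool using (Bool; true; false; not; _xor_; if_then_else_)
open import Data.Bool.Properties using (not-involutive; xor-comm; not-distribˡ-xor)
import Data.Bool.Properties as Bool
open import Data.Fin using (Fin; zero; suc; toℕ)
import Data.Fin.Properties as Fin
open import Data.Fin.Subset using (Subset; inside; outside; ⁅_⁆; _∪_; ∣_∣; ⊥; _∈_)
open import Data.Fin.Subset.Properties
  using (∪-identityˡ; ∪-identityʳ; ∪-assoc; ∪-comm; ∪-idem; ∣⁅x⁆∣≡1; x∈p∪q⁺; x∈p∪q⁻; x∈⁅x⁆; x∈⁅y⁆⇒x≡y)
open import Data.Integer
  using (ℤ; +0; +[1+_]; -[1+_]; 0ℤ; 1ℤ; _+_; _-_; _*_; _≤_; +≤+; +<+; _≤?_; Positive)
open import Data.Integer.Properties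
open import Data.Integer.Tactic.RingSolver using (solve-∀)
open import Data.List using (List; []; _∷_; length; map; allFin; filter; cartesianProduct; tabulate)
import Data.List.Membership.DecPropositional as DecMembership
import Data.List.Membership.Propositional as List
open import Data.List.Membership.Propositional.Properties
  using (∈-map⁻; ∈-map⁺; ∈-deduplicate⁻; ∈-cartesianProduct⁺; ∈-filter⁺; ∈-filter⁻; ∈-allFin)
open import Data.List.Properties using (length-tabulate)
open import Data.List.Relation.Unary.All as All using (All; []; _∷_)
open import Data.List.Relation.Unary.AllPairs using ([]; _∷_)
open import Data.List.Relation.Unary.Any as Any using (Any; here; there; _─_)
open import Data.List.Relation.Unary.Any.Properties using (lookup-result)
open import Data.List.Relation.Unary.Unique.Propositional using (Unique)
open import Data.Nat using (zero; suc; NonZero)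
import Data.Nat as ℕ
open import Data.Nat.DivMod using ([m+kn]%n≡m%n; m≡m%n+[m/n]*n; m%n<n)
import Data.Nat.Properties as ℕ
import Data.Nat.Tactic.RingSolver as ℕ-Solver
open import Data.Product using (_×_; _,_; proj₁; proj₂; ∃-syntax; Σ-syntax)
open import Data.Product.Properties using (≡-dec)
open import Data.Rational.Unnormalised using (*<*)
open import Data.Sum using (_⊎_; inj₁; inj₂)
open import Data.Vec using ([]; _∷_; lookup; _[_]≔_)
import Data.Vec.Properties as Vec
open import Function using (_∘_; const; id; mk⇔)
open import Relation.Binary.Definitions using (DecidableEquality)
open import Relation.Binary.PropositionalEquality
open import Relation.Nullary using (Dec; yes; no; does; contradiction; ¬_)
open import Relation.Nullary.Decidable using (map′; _×-dec_; from-yes; dec-true; dec-false)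
open import Relation.Unary using (Decidable)

-- Integer inequalities

infixl 6 _⊕_
infixl 7 _⊗_

_⊕_ : ∀ {i j} → 0ℤ ≤ i → 0ℤ ≤ j → 0ℤ ≤ i + j
_⊕_ = +-mono-≤

_⊗_ : ∀ {i j} → 0ℤ ≤ i → 0ℤ ≤ j → 0ℤ ≤ i * j
_⊗_ {+ m} {j} _ 0≤j = subst (_≤ + m * j) (*-zeroʳ (+ m)) (*-monoˡ-≤-nonNeg (+ m) 0≤j)

0≤+ : ∀ {n} → 0ℤ ≤ + n
0≤+ = +≤+ ℕ.z≤n

0≤sq : ∀ i → 0ℤ ≤ i * i
0≤sq (+ n)     = 0≤+ {n} ⊗ 0≤+ {n}
0≤sq -[1+ n ] = 0≤+

gap : ∀ {i j} → i ≤ j → 0ℤ ≤ j - i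
gap = i≤j⇒0≤j-i

≤-by : ∀ {i j} z → j - i ≡ z → 0ℤ ≤ z → i ≤ j
≤-by z eq 0≤z = 0≤i-j⇒j≤i (subst (0ℤ ≤_) (sym eq) 0≤z)

≤-by-multiple : ∀ c .{{_ : Positive c}} {i j} z → c * (j - i) ≡ z → 0ℤ ≤ z → i ≤ j
≤-by-multiple c {i} {j} z eq 0≤z = 0≤i-j⇒j≤i (*-cancelˡ-≤-pos 0ℤ (j - i) c
  (subst₂ _≤_ (sym (*-zeroʳ c)) (sym eq) 0≤z))

-- With s = R + U and q = I + B, 2R² + 2U² ≤ 2s² ≤ 2sq and 4IB ≤ q², so the left side is at most (s
-- + q + C)² ≤ k².
vertex-bound : ∀ {k R B U I C} → 0ℤ ≤ R → 0ℤ ≤ B → 0ℤ ≤ U → 0ℤ ≤ I → 0ℤ ≤ C →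
  R + U ≤ I + B → R + B + U + I + C ≤ k →
  + 2 * (R * R) + + 2 * (U * U) + + 4 * (I * B) + C * C ≤ k * k
vertex-bound {k} {R} {B} {U} {I} {C} r b u i c s≤q Σ≤k = ≤-by _ (identity k R B U I C)
  (gap Σ≤k ⊗ (gap Σ≤k ⊕ 0≤+ {2} ⊗ (r ⊕ b ⊕ u ⊕ i ⊕ c))
   ⊕ 0≤sq (I - B) ⊕ 0≤sq (R + U) ⊕ 0≤+ {2} ⊗ ((r ⊕ u) ⊗ gap s≤q)
   ⊕ 0≤+ {4} ⊗ (r ⊗ u) ⊕ 0≤+ {2} ⊗ (c ⊗ (r ⊕ u ⊕ (i ⊕ b))))
  where
  identity : ∀ k R B U I C →
    k * k - (+ 2 * (R * R) + + 2 * (U * U) + + 4 * (I * B) + C * C) ≡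
    (k - (R + B + U + I + C)) * (k - (R + B + U + I + C) + + 2 * (R + B + U + I + C))
    + (I - B) * (I - B) + (R + U) * (R + U) + + 2 * ((R + U) * (I + B - (R + U)))
    + + 4 * (R * U) + + 2 * (C * (R + U + (I + B)))
  identity = solve-∀

-- A linear form of z ≤ min(p², Q) ≤ p √Q, with 4m √Q ≤ 4Q + m².
min-square-bound : ∀ {m p z Q} → 0ℤ ≤ p → 0ℤ ≤ z → z ≤ p * p → z ≤ Q →
  + 4 * (m * z) ≤ p * (+ 4 * Q + m * m)
min-square-bound {m} {+0} {z} {Q} p 0≤z z≤p² z≤Q =
  subst (λ z → + 4 * (m * z) ≤ 0ℤ) (≤-antisym 0≤z z≤p²) (≤-reflexive (zeros m))
  where
  zeros : ∀ m → + 4 * (m * 0ℤ) ≡ 0ℤ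
  zeros = solve-∀
min-square-bound {m} {p@(+[1+ _ ])} {z} {Q} 0≤p 0≤z z≤p² z≤Q = ≤-by-multiple p _ (identity m p z Q)
  (0≤+ {4} ⊗ (0≤p ⊗ 0≤p ⊗ gap z≤Q) ⊕ 0≤sq (p * m - + 2 * z) ⊕ 0≤+ {4} ⊗ (0≤z ⊗ gap z≤p²))
  where
  identity : ∀ m p z Q → p * (p * (+ 4 * Q + m * m) - + 4 * (m * z)) ≡
    + 4 * (p * p * (Q - z)) + (p * m - + 2 * z) * (p * m - + 2 * z) + + 4 * (z * (p * p - z))
  identity = solve-∀

-- (m + 1)⁴ - m⁴ - 1
linkBound : ℤ → ℤ
linkBound m = + 4 * (m * m * m) + + 6 * (m * m) + + 4 * m

-- R, B, U, C count ordered pairs, m = 1 + q.  Given R and B, hypothesis w leaves a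
-- choice between pairs counted by 2U and by C, whose coefficients in the bound on
-- 8mT are 12B + 3m² and 4m²; hence the case distinction on 12B against m².
module _ {q T R B U C : ℤ} (0≤q : 0ℤ ≤ q)
  (r : 0ℤ ≤ R) (b : 0ℤ ≤ B) (u : 0ℤ ≤ U) (c : 0ℤ ≤ C)
  (w : R + B + + 2 * U + C ≤ (1ℤ + q) * q)
  (h : + 4 * ((1ℤ + q) * T) ≤ R * (+ 4 * R + (1ℤ + q) * (1ℤ + q))
         + + 3 * (U * (+ 4 * B + (1ℤ + q) * (1ℤ + q))) + + 2 * ((1ℤ + q) * (1ℤ + q) * C))
  where

  private
    m = 1ℤ + q
    0≤m : 0ℤ ≤ m
    0≤m = 0≤+ {1} ⊕ 0≤q

  -- The case b = r up to rounding: the deletion of one vertex that reverses the sign of B - R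
  -- leaves an excess of at most 2q before it.
  crossing-bound : R ≤ B → B - R ≤ + 2 * q → m * (+ 8 * T) ≤ m * linkBound m
  crossing-bound R≤B x≤2q with ≤-total (m * m) (+ 12 * B)
  -- Cyclic pairs are exchanged for arrows. At R = B the leading part is then 4m⁴ - (m² - 4B)²,
  -- hence the square, up to terms in m and B - R. The lower terms of `linkBound` pay for the excess
  -- B - R.
  ... | inj₁ m²≤12B = ≤-by-multiple (+ 4) _ (identity q T R B U C)
    (0≤+ {8} ⊗ gap h ⊕ 0≤+ {4} ⊗ ((0≤+ {12} ⊗ b ⊕ 0≤+ {3} ⊗ (0≤m ⊗ 0≤m)) ⊗ gap w)
     ⊕ 0≤+ {4} ⊗ (c ⊗ gap m²≤12B)
     ⊕ 0≤sq (+ 8 * B - + 2 * (m * m) + + 3 * m + (B - R))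
     ⊕ (0≤+ {48} ⊗ (0≤q ⊗ 0≤q ⊗ 0≤q) ⊕ 0≤+ {7} ⊗ (0≤q ⊗ 0≤q) ⊕ 0≤+ {146} ⊗ 0≤q ⊕ 0≤+ {55})
     ⊕ 0≤+ {6} ⊗ (0≤m ⊗ gap x≤2q)
     ⊕ 0≤+ {33} ⊗ (gap x≤2q ⊗ (0≤+ {2} ⊗ 0≤q ⊕ gap R≤B)))
    where
    identity : ∀ q T R B U C → let m = 1ℤ + q in
      + 4 * (m * (+ 4 * (m * m * m) + + 6 * (m * m) + + 4 * m) - m * (+ 8 * T)) ≡
      + 8 * (R * (+ 4 * R + m * m) + + 3 * (U * (+ 4 * B + m * m)) + + 2 * (m * m * C) - + 4 * (m * T))
      + + 4 * ((+ 12 * B + + 3 * (m * m)) * (m * q - (R + B + + 2 * U + C)))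
      + + 4 * (C * (+ 12 * B - m * m))
      + (+ 8 * B - + 2 * (m * m) + + 3 * m + (B - R)) * (+ 8 * B - + 2 * (m * m) + + 3 * m + (B - R))
      + (+ 48 * (q * q * q) + + 7 * (q * q) + + 146 * q + + 55)
      + + 6 * (m * (+ 2 * q - (B - R)))
      + + 33 * ((+ 2 * q - (B - R)) * (+ 2 * q + (B - R)))
    identity = solve-∀
  -- Arrows are exchanged for cyclic pairs. What remains is 8R² ≤ 2m²R + 4m²B, from R ≤ B and R + B
  -- ≤ m².
  ... | inj₂ 12B≤m² = ≤-by _ (identity q T R B U C)
    (0≤+ {2} ⊗ gap h ⊕ 0≤+ {4} ⊗ (0≤m ⊗ 0≤m ⊗ gap w) ⊕ 0≤+ {2} ⊗ (u ⊗ gap 12B≤m²)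
     ⊕ 0≤+ {4} ⊗ (0≤m ⊗ 0≤m ⊗ gap R≤B)
     ⊕ r ⊗ (0≤+ {2} ⊗ (0≤m ⊗ 0≤m) ⊕ 0≤+ {4} ⊗ (gap w ⊕ (0≤m ⊕ 0≤+ {2} ⊗ u ⊕ c)) ⊕ 0≤+ {4} ⊗ gap R≤B)
     ⊕ (0≤+ {10} ⊗ (0≤m ⊗ 0≤m ⊗ 0≤m) ⊕ 0≤+ {4} ⊗ (0≤m ⊗ 0≤m)))
    where
    identity : ∀ q T R B U C → let m = 1ℤ + q in
      m * (+ 4 * (m * m * m) + + 6 * (m * m) + + 4 * m) - m * (+ 8 * T) ≡
      + 2 * (R * (+ 4 * R + m * m) + + 3 * (U * (+ 4 * B + m * m)) + + 2 * (m * m * C) - + 4 * (m * T))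
      + + 4 * (m * m * (m * q - (R + B + + 2 * U + C)))
      + + 2 * (U * (m * m - + 12 * B))
      + + 4 * (m * m * (B - R))
      + R * (+ 2 * (m * m) + + 4 * (m * q - (R + B + + 2 * U + C) + (m + + 2 * U + C)) + + 4 * (B - R))
      + (+ 10 * (m * m * m) + + 4 * (m * m))
    identity = solve-∀

  -- The case b ≤ r, 2r ≤ o. The number of ordered pairs is relaxed from mq to m², so the lower
  -- terms 6m³ + 4m² of m * `linkBound m` are left over as slack.
  few-blue-bound : R ≤ U → B ≤ R → m * (+ 8 * T) ≤ m * linkBound m
  few-blue-bound R≤U B≤R with ≤-total (m * m) (+ 12 * B)
  -- Cyclic pairs are exchanged for arrows. The remaining leading terms all vanish at R = B = m²/4,
  -- where the bound is asymptotically tight.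
  ... | inj₁ m²≤12B = ≤-by-multiple (+ 9) _ (identity q T R B U C)
    (0≤+ {18} ⊗ gap h ⊕ 0≤+ {9} ⊗ ((0≤+ {12} ⊗ b ⊕ 0≤+ {3} ⊗ (0≤m ⊗ 0≤m)) ⊗ (gap w ⊕ 0≤m))
     ⊕ 0≤+ {9} ⊗ (c ⊗ gap m²≤12B)
     ⊕ 0≤+ {24} ⊗ (gap B≤R ⊗ g₂) ⊕ 0≤+ {5} ⊗ ((g₂ ⊕ 0≤+ {3} ⊗ gap B≤R) ⊗ g₂)
     ⊕ 0≤+ {4} ⊗ 0≤sq (m * m - + 4 * B)
     ⊕ 0≤+ {9} ⊗ (0≤+ {6} ⊗ (0≤m ⊗ 0≤m ⊗ 0≤m) ⊕ 0≤+ {4} ⊗ (0≤m ⊗ 0≤m)))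
    where
    -- This is m² - 3R - B ≥ 0: the arrows, counted in both directions, occupy at least 2R ordered
    -- pairs.
    g₂ = gap w ⊕ 0≤m ⊕ 0≤+ {2} ⊗ gap R≤U ⊕ c
    identity : ∀ q T R B U C → let
        m = 1ℤ + q
        g₂ = m * q - (R + B + + 2 * U + C) + m + + 2 * (U - R) + C in
      + 9 * (m * (+ 4 * (m * m * m) + + 6 * (m * m) + + 4 * m) - m * (+ 8 * T)) ≡
      + 18 * (R * (+ 4 * R + m * m) + + 3 * (U * (+ 4 * B + m * m)) + + 2 * (m * m * C) - + 4 * (m * T))
      + + 9 * ((+ 12 * B + + 3 * (m * m)) * (m * q - (R + B + + 2 * U + C) + m))
      + + 9 * (C * (+ 12 * B - m * m))
      + + 24 * ((R - B) * g₂) + + 5 * ((g₂ + + 3 * (R - B)) * g₂)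
      + + 4 * ((m * m - + 4 * B) * (m * m - + 4 * B))
      + + 9 * (+ 6 * (m * m * m) + + 4 * (m * m))
    identity = solve-∀
  -- Only the arrows beyond the forced U = R are exchanged for cyclic pairs.
  ... | inj₂ 12B≤m² = ≤-by-multiple (+ 3) _ (identity q T R B U C)
    (0≤+ {6} ⊗ gap h ⊕ 0≤+ {12} ⊗ (0≤m ⊗ 0≤m ⊗ (gap w ⊕ 0≤m))
     ⊕ 0≤+ {6} ⊗ (gap R≤U ⊗ gap 12B≤m²)
     ⊕ 0≤+ {4} ⊗ (r ⊗ gap 12B≤m²) ⊕ 0≤+ {8} ⊗ (r ⊗ g₂)
     ⊕ b ⊗ (0≤+ {12} ⊗ g₂ ⊕ 0≤+ {20} ⊗ r ⊕ 0≤+ {12} ⊗ b)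
     ⊕ 0≤+ {3} ⊗ (0≤+ {6} ⊗ (0≤m ⊗ 0≤m ⊗ 0≤m) ⊕ 0≤+ {4} ⊗ (0≤m ⊗ 0≤m)))
    where
    g₂ = gap w ⊕ 0≤m ⊕ 0≤+ {2} ⊗ gap R≤U ⊕ c
    identity : ∀ q T R B U C → let
        m = 1ℤ + q
        g₂ = m * q - (R + B + + 2 * U + C) + m + + 2 * (U - R) + C in
      + 3 * (m * (+ 4 * (m * m * m) + + 6 * (m * m) + + 4 * m) - m * (+ 8 * T)) ≡
      + 6 * (R * (+ 4 * R + m * m) + + 3 * (U * (+ 4 * B + m * m)) + + 2 * (m * m * C) - + 4 * (m * T))
      + + 12 * (m * m * (m * q - (R + B + + 2 * U + C) + m))
      + + 6 * ((U - R) * (m * m - + 12 * B))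
      + + 4 * (R * (m * m - + 12 * B)) + + 8 * (R * g₂)
      + B * (+ 12 * g₂ + + 20 * R + + 12 * B)
      + + 3 * (+ 6 * (m * m * m) + + 4 * (m * m))
    identity = solve-∀

-- Sums over lists

private
  variable
    A A′ : Set

∑ : List A → (A → ℤ) → ℤ
∑ []       f = 0ℤ
∑ (x ∷ xs) f = f x + ∑ xs f

∑₂ : List A → (A → A → ℤ) → ℤ
∑₂ xs f = ∑ xs λ x → ∑ xs (f x)

∑₃ : List A → (A → A → A → ℤ) → ℤ
∑₃ xs f = ∑ xs λ x → ∑₂ xs (f x)

∑₄ : List A → (A → A → A → A → ℤ) → ℤ
∑₄ xs f = ∑ xs λ x → ∑₃ xs (f x)

∑-mono : ∀ xs {f g : A → ℤ} → (∀ x → f x ≤ g x) → ∑ xs f ≤ ∑ xs g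
∑-mono []       f≤g = ≤-refl
∑-mono (x ∷ xs) f≤g = +-mono-≤ (f≤g x) (∑-mono xs f≤g)

∑-cong : ∀ xs {f g : A → ℤ} → (∀ x → f x ≡ g x) → ∑ xs f ≡ ∑ xs g
∑-cong []       f≡g = refl
∑-cong (x ∷ xs) f≡g = cong₂ _+_ (f≡g x) (∑-cong xs f≡g)

∑-zero : ∀ (xs : List A) → ∑ xs (λ _ → 0ℤ) ≡ 0ℤ
∑-zero []       = refl
∑-zero (x ∷ xs) = trans (+-identityˡ _) (∑-zero xs)

∑-nonneg : ∀ xs {f : A → ℤ} → (∀ x → 0ℤ ≤ f x) → 0ℤ ≤ ∑ xs f
∑-nonneg []       0≤f = ≤-refl
∑-nonneg (x ∷ xs) 0≤f = 0≤f x ⊕ ∑-nonneg xs 0≤f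

∑-one : ∀ (xs : List A) → ∑ xs (λ _ → 1ℤ) ≡ + length xs
∑-one []       = refl
∑-one (x ∷ xs) = cong (λ s → 1ℤ + s) (∑-one xs)

∑-+ : ∀ xs (f g : A → ℤ) → ∑ xs (λ x → f x + g x) ≡ ∑ xs f + ∑ xs g
∑-+ []       f g = refl
∑-+ (x ∷ xs) f g = trans (cong (λ s → f x + g x + s) (∑-+ xs f g)) (interchange (f x) (g x) (∑ xs f) (∑ xs g))
  where
  interchange : ∀ a b c d → a + b + (c + d) ≡ a + c + (b + d)
  interchange = solve-∀

∑-*ˡ : ∀ xs c (f : A → ℤ) → ∑ xs (λ x → c * f x) ≡ c * ∑ xs f
∑-*ˡ []       c f = sym (*-zeroʳ c)
∑-*ˡ (x ∷ xs) c f = trans (cong (λ s → c * f x + s) (∑-*ˡ xs c f)) (sym (*-distribˡ-+ c (f x) (∑ xs f)))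

∑-*ʳ : ∀ xs c (f : A → ℤ) → ∑ xs (λ x → f x * c) ≡ ∑ xs f * c
∑-*ʳ xs c f = trans (∑-cong xs λ x → *-comm (f x) c) (trans (∑-*ˡ xs c f) (*-comm c _))

∑-swap : ∀ xs (ys : List A′) (f : A → A′ → ℤ) →
  ∑ xs (λ x → ∑ ys (f x)) ≡ ∑ ys (λ y → ∑ xs (λ x → f x y))
∑-swap []       ys f = sym (∑-zero ys)
∑-swap (x ∷ xs) ys f = trans (cong (λ s → ∑ ys (f x) + s) (∑-swap xs ys f))
  (sym (∑-+ ys (f x) (λ y → ∑ xs (λ x → f x y))))

-- Deleting one occurrence from a list

module _ {P : A → Set} where

  ∑-─ : ∀ xs (p : Any P xs) (f : A → ℤ) → ∑ xs f ≡ f (Any.lookup p) + ∑ (xs ─ p) f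
  ∑-─ (x ∷ xs) (here px) f = refl
  ∑-─ (x ∷ xs) (there p) f = trans (cong (λ s → f x + s) (∑-─ xs p f)) (swapˡ (f x) (f (Any.lookup p)) (∑ (xs ─ p) f))
    where
    swapˡ : ∀ a b c → a + (b + c) ≡ b + (a + c)
    swapˡ = solve-∀

  length-─ : ∀ (xs : List A) (p : Any P xs) → length xs ≡ ℕ.suc (length (xs ─ p))
  length-─ (x ∷ xs) (here px) = refl
  length-─ (x ∷ xs) (there p) = cong ℕ.suc (length-─ xs p)

  module _ (xs : List A) (p : Any P xs) where

    private
      a  = Any.lookup p
      ys = xs ─ p

    ∑₂-─ : ∀ (f : A → A → ℤ) → f a a ≡ 0ℤ →
      ∑₂ xs f ≡ ∑₂ ys f + (∑ ys (f a) + ∑ ys λ x → f x a)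
    ∑₂-─ f faa = begin
      ∑₂ xs f                                                ≡⟨ ∑-─ xs p _ ⟩
      ∑ xs (f a) + ∑ ys (λ x → ∑ xs (f x))                   ≡⟨ cong₂ _+_ (∑-─ xs p (f a)) (∑-cong ys λ x → ∑-─ xs p (f x)) ⟩
      f a a + ∑ ys (f a) + ∑ ys (λ x → f x a + ∑ ys (f x))   ≡⟨ cong₂ (λ s t → s + ∑ ys (f a) + t) faa (∑-+ ys _ _) ⟩
      0ℤ + ∑ ys (f a) + (∑ ys (λ x → f x a) + ∑₂ ys f)       ≡⟨ rearrange (∑ ys (f a)) (∑ ys λ x → f x a) (∑₂ ys f) ⟩
      ∑₂ ys f + (∑ ys (f a) + ∑ ys λ x → f x a)              ∎
      where
      open ≡-Reasoning
      rearrange : ∀ a b c → 0ℤ + a + (b + c) ≡ c + (a + b)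
      rearrange = solve-∀

    -- As `f` vanishes on repeated arguments, each nonzero lost term has the deleted occurrence in
    -- exactly one of the three places.
    ∑₃-─ : ∀ (f : A → A → A → ℤ) →
      (∀ x y → f x x y ≡ 0ℤ) → (∀ x y → f x y x ≡ 0ℤ) → (∀ x y → f y x x ≡ 0ℤ) →
      ∑₃ xs f ≡ ∑₃ ys f + (∑₂ ys (f a) + ∑₂ ys (λ x y → f x a y) + ∑₂ ys (λ x y → f x y a))
    ∑₃-─ f fxxy fxyx fyxx = begin
      ∑₃ xs f
        ≡⟨ ∑-─ xs p _ ⟩
      ∑₂ xs (f a) + ∑ ys (λ x → ∑₂ xs (f x))
        ≡⟨ cong₂ _+_ (∑₂-─ (f a) (fxxy a a)) (∑-cong ys λ x → ∑₂-─ (f x) (fyxx a x)) ⟩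
      ∑₂ ys (f a) + (∑ ys (f a a) + ∑ ys λ x → f a x a)
        + ∑ ys (λ x → ∑₂ ys (f x) + (∑ ys (f x a) + ∑ ys λ y → f x y a))
        ≡⟨ cong₂ (λ s t → ∑₂ ys (f a) + s + t)
             (cong₂ _+_ (trans (∑-cong ys (fxxy a)) (∑-zero ys)) (trans (∑-cong ys (fxyx a)) (∑-zero ys)))
             (trans (∑-+ ys _ _) (cong (λ s → ∑₃ ys f + s) (∑-+ ys _ _))) ⟩
      ∑₂ ys (f a) + (0ℤ + 0ℤ) + (∑₃ ys f + (∑₂ ys (λ x y → f x a y) + ∑₂ ys (λ x y → f x y a)))
        ≡⟨ rearrange (∑₂ ys (f a)) (∑₃ ys f) (∑₂ ys λ x → f x a) (∑₂ ys λ x y → f x y a) ⟩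
      ∑₃ ys f + (∑₂ ys (f a) + ∑₂ ys (λ x y → f x a y) + ∑₂ ys (λ x y → f x y a)) ∎
      where
      open ≡-Reasoning
      rearrange : ∀ a b c d → a + (0ℤ + 0ℤ) + (b + (c + d)) ≡ b + (a + c + d)
      rearrange = solve-∀

-- Averaging over a nonempty list. The witness is an `Any`, so it carries the position that `─`
-- deletes afterwards.
∑-≤⇒Any : ∀ x xs {f g : A → ℤ} → ∑ (x ∷ xs) f ≤ ∑ (x ∷ xs) g → Any (λ x → f x ≤ g x) (x ∷ xs)
∑-≤⇒Any x xs {f} {g} ∑≤ with f x ≤? g x
... | yes fx≤gx = here fx≤gx
∑-≤⇒Any x [] {f} {g} ∑≤ | no fx≰gx =
  contradiction (subst₂ _≤_ (+-identityʳ (f x)) (+-identityʳ (g x)) ∑≤) fx≰gx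
∑-≤⇒Any x (y ∷ ys) {f} {g} ∑≤ | no fx≰gx =
  there (∑-≤⇒Any y ys (≤-by _ (cancel (f x) (g x) (∑ (y ∷ ys) f) (∑ (y ∷ ys) g)) (gap ∑≤ ⊕ gap (<⇒≤ (≰⇒> fx≰gx)))))
  where
  cancel : ∀ a b c d → d - c ≡ (b + d - (a + c)) + (a - b)
  cancel = solve-∀

∑₂-* : ∀ xs (f g : A → ℤ) → ∑₂ xs (λ x y → f x * g y) ≡ ∑ xs f * ∑ xs g
∑₂-* xs f g = trans (∑-cong xs λ x → ∑-*ˡ xs (f x) g) (∑-*ʳ xs (∑ xs g) f)

∑₂-mono : ∀ xs {f g : A → A → ℤ} → (∀ x y → f x y ≤ g x y) → ∑₂ xs f ≤ ∑₂ xs g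
∑₂-mono xs f≤g = ∑-mono xs λ x → ∑-mono xs (f≤g x)

∑₂-+ : ∀ xs (f g : A → A → ℤ) → ∑₂ xs (λ x y → f x y + g x y) ≡ ∑₂ xs f + ∑₂ xs g
∑₂-+ xs f g = trans (∑-cong xs λ x → ∑-+ xs (f x) (g x)) (∑-+ xs _ _)

∑₂-*ˡ : ∀ xs c (f : A → A → ℤ) → ∑₂ xs (λ x y → c * f x y) ≡ c * ∑₂ xs f
∑₂-*ˡ xs c f = trans (∑-cong xs λ x → ∑-*ˡ xs c (f x)) (∑-*ˡ xs c _)

∑₃-mono : ∀ xs {f g : A → A → A → ℤ} → (∀ x y z → f x y z ≤ g x y z) → ∑₃ xs f ≤ ∑₃ xs g
∑₃-mono xs f≤g = ∑-mono xs λ x → ∑₂-mono xs (f≤g x)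

∑₃-cong : ∀ xs {f g : A → A → A → ℤ} → (∀ x y z → f x y z ≡ g x y z) → ∑₃ xs f ≡ ∑₃ xs g
∑₃-cong xs f≡g = ∑-cong xs λ x → ∑-cong xs λ y → ∑-cong xs (f≡g x y)

∑₃-+ : ∀ xs (f g : A → A → A → ℤ) → ∑₃ xs (λ x y z → f x y z + g x y z) ≡ ∑₃ xs f + ∑₃ xs g
∑₃-+ xs f g = trans (∑-cong xs λ x → ∑₂-+ xs (f x) (g x)) (∑-+ xs _ _)

∑₃-*ˡ : ∀ xs c (f : A → A → A → ℤ) → ∑₃ xs (λ x y z → c * f x y z) ≡ c * ∑₃ xs f
∑₃-*ˡ xs c f = trans (∑-cong xs λ x → ∑₂-*ˡ xs c (f x)) (∑-*ˡ xs c _)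

∑₃-swap₁₂ : ∀ xs (f : A → A → A → ℤ) → ∑₃ xs (λ x y z → f y x z) ≡ ∑₃ xs f
∑₃-swap₁₂ xs f = ∑-swap xs xs λ x y → ∑ xs (f y x)

∑₃-swap₂₃ : ∀ xs (f : A → A → A → ℤ) → ∑₃ xs (λ x y z → f x z y) ≡ ∑₃ xs f
∑₃-swap₂₃ xs f = ∑-cong xs λ x → ∑-swap xs xs λ y z → f x z y

∑₂-irreflexive-≤ : ∀ xs {f : A → A → ℤ} → (∀ x → f x x ≡ 0ℤ) → (∀ x y → f x y ≤ 1ℤ) →
  ∑₂ xs f + (+ length xs) ≤ (+ length xs) * (+ length xs)
∑₂-irreflexive-≤ []               fxx f≤1 = ≤-refl
∑₂-irreflexive-≤ xs@(x ∷ ys) {f} fxx f≤1 = ≤-by _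
  (trans (cong (λ s → (1ℤ + m) * (1ℤ + m) - (s + (1ℤ + m))) (∑₂-─ xs (here {P = λ _ → x ≡ x} refl) f (fxx x)))
         (identity m (∑₂ ys f) (∑ ys (f x)) (∑ ys λ y → f y x)))
  (gap (∑₂-irreflexive-≤ ys fxx f≤1) ⊕ gap (row (f x) (f≤1 x)) ⊕ gap (row _ λ y → f≤1 y x))
  where
  m = + length ys
  row : ∀ g → (∀ y → g y ≤ 1ℤ) → ∑ ys g ≤ m
  row g g≤1 = ≤-trans (∑-mono ys g≤1) (≤-reflexive (∑-one ys))
  identity : ∀ m s a b → (1ℤ + m) * (1ℤ + m) - (s + (a + b) + (1ℤ + m)) ≡ (m * m - (s + m)) + (m - a) + (m - b)
  identity = solve-∀

∑₄-─ : ∀ {P : A → Set} xs (p : Any P xs) → let a = Any.lookup p; ys = xs ─ p in ∀ (f : A → A → A → A → ℤ) →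
  (∀ x y z → f x x y z ≡ 0ℤ) → (∀ x y z → f x y x z ≡ 0ℤ) → (∀ x y z → f x y z x ≡ 0ℤ) →
  (∀ x y z → f x y y z ≡ 0ℤ) → (∀ x y z → f x y z y ≡ 0ℤ) → (∀ x y z → f x y z z ≡ 0ℤ) →
  ∑₄ xs f ≡ ∑₄ ys f + (∑₃ ys (f a) + ∑₃ ys (λ x y z → f x a y z)
    + ∑₃ ys (λ x y z → f x y a z) + ∑₃ ys (λ x y z → f x y z a))
∑₄-─ xs p f f12 f13 f14 f23 f24 f34 = begin
  ∑₄ xs f
    ≡⟨ ∑-─ xs p _ ⟩
  ∑₃ xs (f a) + ∑ ys (λ x → ∑₃ xs (f x))
    ≡⟨ cong₂ _+_ (∑₃-─ xs p (f a) (f23 a) (f24 a) (λ x y → f34 a y x))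
         (∑-cong ys λ x → ∑₃-─ xs p (f x) (f23 x) (f24 x) (λ y z → f34 x z y)) ⟩
  ∑₃ ys (f a) + (∑₂ ys (f a a) + ∑₂ ys (λ x y → f a x a y) + ∑₂ ys (λ x y → f a x y a))
    + ∑ ys (λ x → ∑₃ ys (f x) + (∑₂ ys (f x a) + ∑₂ ys (λ y z → f x y a z) + ∑₂ ys (λ y z → f x y z a)))
    ≡⟨ cong₂ (λ s t → ∑₃ ys (f a) + s + t)
         (cong₂ _+_ (cong₂ _+_ (zeros (f12 a)) (zeros (f13 a))) (zeros (f14 a)))
         (trans (∑-+ ys _ _) (cong (λ s → ∑₄ ys f + s) (trans (∑-+ ys _ _)
           (cong (_+ ∑₃ ys (λ x y z → f x y z a)) (∑-+ ys _ _))))) ⟩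
  ∑₃ ys (f a) + (0ℤ + 0ℤ + 0ℤ)
    + (∑₄ ys f + (∑₃ ys (λ x → f x a) + ∑₃ ys (λ x y z → f x y a z) + ∑₃ ys (λ x y z → f x y z a)))
    ≡⟨ rearrange (∑₃ ys (f a)) (∑₄ ys f) (∑₃ ys λ x → f x a) (∑₃ ys λ x y z → f x y a z) (∑₃ ys λ x y z → f x y z a) ⟩
  ∑₄ ys f + (∑₃ ys (f a) + ∑₃ ys (λ x → f x a) + ∑₃ ys (λ x y z → f x y a z) + ∑₃ ys (λ x y z → f x y z a)) ∎
  where
  open ≡-Reasoning
  a  = Any.lookup p
  ys = xs ─ p
  zeros : ∀ {g : _ → _ → ℤ} → (∀ x y → g x y ≡ 0ℤ) → ∑₂ ys g ≡ 0ℤ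
  zeros g≡0 = trans (∑-cong ys λ x → trans (∑-cong ys (g≡0 x)) (∑-zero ys)) (∑-zero ys)
  rearrange : ∀ a b c d e → a + (0ℤ + 0ℤ + 0ℤ) + (b + (c + d + e)) ≡ b + (a + c + d + e)
  rearrange = solve-∀

-- Labelled pairs

-- Label of an ordered pair ab: out is the arrow a → b, inn is b → a, and cw, ccw are
-- the two directions of a cyclic pair.
data Label : Set where
  none red blue out inn cw ccw : Label

flip : Label → Label
flip out = inn
flip inn = out
flip cw  = ccw
flip ccw = cw
flip l   = l

is : Label → Label → ℤ
is red  red  = 1ℤ
is blue blue = 1ℤ
is out  out  = 1ℤ
is inn  inn  = 1ℤ
is cw   cw   = 1ℤ
is ccw  ccw  = 1ℤ
is _    _    = 0ℤ

-- Turns universal statements about labels into finite computations, from which `from-yes` extracts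
-- the proofs below.
all? : ∀ {P : Label → Set} → Decidable P → Dec (∀ l → P l)
all? P? = map′
  (λ (n , r , b , o , i , c , c′) → λ where
    none → n; red → r; blue → b; out → o; inn → i; cw → c; ccw → c′)
  (λ p → p none , p red , p blue , p out , p inn , p cw , p ccw)
  (P? none ×-dec P? red ×-dec P? blue ×-dec P? out ×-dec P? inn ×-dec P? cw ×-dec P? ccw)

0≤is : ∀ k l → 0ℤ ≤ is k l
0≤is = from-yes (all? λ k → all? λ l → 0ℤ ≤? is k l)

is≤1 : ∀ k l → is k l ≤ 1ℤ
is≤1 = from-yes (all? λ k → all? λ l → is k l ≤? 1ℤ)

is-none : ∀ k → is k none ≡ 0ℤ
is-none = from-yes (all? λ k → is k none ≟ 0ℤ)

is-flip : ∀ l → is out (flip l) ≡ is inn l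
is-flip = from-yes (all? λ l → is out (flip l) ≟ is inn l)

-- An apex x joined to y and z by label `k`, over a base yz of label `l`. The choice `red red` is a
-- red triangle; `out blue` is a blue pair with arrows to it from x.
spoke : Label → Label → Label → Label → Label → ℤ
spoke k l l₁ l₂ l₃ = is k l₁ * is k l₃ * is l l₂

-- The arguments of rim, like those of patterns and weight, are the labels of
-- xy, yz and xz.
rim : Label → Label → Label → ℤ
rim l₁ l₂ l₃ = is cw l₁ * is cw l₂ * is ccw l₃

-- The flips re-read the same three pairs with apex y or z, and the last `rim` with y and z
-- exchanged, so that every admissible shape on xyz is seen in any order of its vertices.
patterns : Label → Label → Label → ℤ
patterns l₁ l₂ l₃ = spoke red red l₁ l₂ l₃
  + (spoke out blue l₁ l₂ l₃ + spoke out blue (flip l₁) l₃ l₂ + spoke out blue (flip l₃) l₁ (flip l₂))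
  + (rim l₁ l₂ l₃ + rim l₃ (flip l₂) l₁)

0≤patterns : ∀ j k l → 0ℤ ≤ patterns j k l
0≤patterns = from-yes (all? λ j → all? λ k → all? λ l → 0ℤ ≤? patterns j k l)

-- One representative per shape: in a sum over all ordered triples the three apexes contribute
-- equally, as do the two orientations of a cyclic triangle.
weight : Label → Label → Label → ℤ
weight l₁ l₂ l₃ = spoke red red l₁ l₂ l₃ + + 3 * spoke out blue l₁ l₂ l₃ + + 2 * rim l₁ l₂ l₃

weight-none₁ : ∀ k l → weight none k l ≡ 0ℤ
weight-none₁ = from-yes (all? λ k → all? λ l → weight none k l ≟ 0ℤ)

weight-none₂ : ∀ k l → weight k none l ≡ 0ℤ
weight-none₂ = from-yes (all? λ k → all? λ l → weight k none l ≟ 0ℤ)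

weight-none₃ : ∀ k l → weight k l none ≡ 0ℤ
weight-none₃ = from-yes (all? λ k → all? λ l → weight k l none ≟ 0ℤ)

-- For labels j, k, l of ax, ay, xy: the three positions of a among x and y.
vertexWeight : Label → Label → Label → ℤ
vertexWeight j k l = weight j l k + weight (flip j) k l + weight l (flip k) (flip j)

-- The label of xy is forgotten, so that the sum over x and y splits into products of degrees of a.
-- The 6 arises when x is the apex: a may then come second or third.
vertexCap : Label → Label → ℤ
vertexCap j k = + 3 * (is red j * is red k) + + 3 * (is out j * is out k) + + 6 * (is inn j * is blue k)
  + + 4 * (is cw j * is ccw k) + + 2 * (is ccw j * is cw k)

vertexWeight≤vertexCap : ∀ j k l → vertexWeight j k l ≤ vertexCap j k
vertexWeight≤vertexCap = from-yes (all? λ j → all? λ k → all? λ l → vertexWeight j k l ≤? vertexCap j k)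

is-red-flip : ∀ l → is red (flip l) ≡ is red l
is-red-flip = from-yes (all? λ l → is red (flip l) ≟ is red l)

is-blue-flip : ∀ l → is blue (flip l) ≡ is blue l
is-blue-flip = from-yes (all? λ l → is blue (flip l) ≟ is blue l)

isPair : Label → ℤ
isPair l = is red l + is blue l + (is out l + is inn l) + (is cw l + is ccw l)

isPair≤1 : ∀ l → isPair l ≤ 1ℤ
isPair≤1 = from-yes (all? λ l → isPair l ≤? 1ℤ)

cyclic≤1 : ∀ l → is cw l + is ccw l ≤ 1ℤ
cyclic≤1 = from-yes (all? λ l → is cw l + is ccw l ≤? 1ℤ)

shrinkʳ : ∀ {i j} → 0ℤ ≤ i → j ≤ 1ℤ → i * j ≤ i
shrinkʳ {i} {j} 0≤i j≤1 = ≤-by _ (identity i j) (0≤i ⊗ gap j≤1)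
  where
  identity : ∀ i j → i - i * j ≡ i * (1ℤ - j)
  identity = solve-∀

shrinkˡ : ∀ {i j} → 0ℤ ≤ j → i ≤ 1ℤ → i * j ≤ j
shrinkˡ {i} {j} 0≤j i≤1 = ≤-trans (≤-reflexive (*-comm i j)) (shrinkʳ 0≤j i≤1)

middle : ∀ {i j k} → 0ℤ ≤ i → 0ℤ ≤ k → j ≤ 1ℤ → i * j * k ≤ i * k
middle {i} {j} {k} 0≤i 0≤k j≤1 = ≤-by _ (identity i j k) (0≤i ⊗ 0≤k ⊗ gap j≤1)
  where
  identity : ∀ i j k → i * k - i * j * k ≡ i * k * (1ℤ - j)
  identity = solve-∀

-- The weighted count of patterns in one link

module Labelling {A : Set} (L : A → A → Label)
  (L-flip : ∀ x y → L y x ≡ flip (L x y)) (L-diag : ∀ x → L x x ≡ none) where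

  on : (Label → Label → Label → ℤ) → A → A → A → ℤ
  on f x y z = f (L x y) (L y z) (L x z)

  deg : Label → A → List A → ℤ
  deg k x S = ∑ S λ y → is k (L x y)

  tot : Label → List A → ℤ
  tot k S = ∑₂ S λ x y → is k (L x y)

  total : List A → ℤ
  total S = ∑₃ S (on weight)

  total-split : ∀ S → total S ≡
    ∑₃ S (on (spoke red red)) + + 3 * ∑₃ S (on (spoke out blue)) + + 2 * ∑₃ S (on rim)
  total-split S = trans (∑₃-+ S _ _) (cong₂ _+_
    (trans (∑₃-+ S _ _) (cong (λ s → ∑₃ S (on (spoke red red)) + s) (∑₃-*ˡ S (+ 3) (on (spoke out blue)))))
    (∑₃-*ˡ S (+ 2) (on rim)))

  ∑-patterns : ∀ S → ∑₃ S (on patterns) ≡ total S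
  ∑-patterns S = begin
    ∑₃ S (on patterns)
      ≡⟨ ∑₃-cong S (λ x y z → cong₂ (λ s t → on r x y z + s + t)
           (cong₂ (λ s t → on h x y z + s + t)
             (cong (λ k → spoke out blue k (L x z) (L y z)) (sym (L-flip x y)))
             (cong₂ (λ k l → spoke out blue k (L x y) l) (sym (L-flip x z)) (sym (L-flip y z))))
           (cong (λ k → on rim x y z + rim (L x z) k (L x y)) (sym (L-flip y z)))) ⟩
    ∑₃ S (λ x y z → on r x y z + (on h x y z + on h y x z + on h z x y) + (on rim x y z + on rim x z y))
      ≡⟨ trans (∑₃-+ S _ _) (cong₂ _+_
           (trans (∑₃-+ S _ _) (cong (λ s → ∑₃ S (on r) + s)
             (trans (∑₃-+ S _ _) (cong₂ _+_ (trans (∑₃-+ S _ _) (cong (λ s → ∑₃ S (on h) + s) (∑₃-swap₁₂ S (on h))))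
               (trans (∑₃-swap₂₃ S (λ x z y → on h z x y)) (∑₃-swap₁₂ S (on h)))))))
           (trans (∑₃-+ S _ _) (cong (λ s → ∑₃ S (on rim) + s) (∑₃-swap₂₃ S (on rim))))) ⟩
    ∑₃ S (on r) + (∑₃ S (on h) + ∑₃ S (on h) + ∑₃ S (on h)) + (∑₃ S (on rim) + ∑₃ S (on rim))
      ≡⟨ collect (∑₃ S (on r)) (∑₃ S (on h)) (∑₃ S (on rim)) ⟩
    ∑₃ S (on r) + + 3 * ∑₃ S (on h) + + 2 * ∑₃ S (on rim)
      ≡⟨ total-split S ⟨
    total S ∎
    where
    open ≡-Reasoning
    r = spoke red red
    h = spoke out blue
    collect : ∀ a b c → a + (b + b + b) + (c + c) ≡ a + + 3 * b + + 2 * c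
    collect = solve-∀

  0≤deg : ∀ k x S → 0ℤ ≤ deg k x S
  0≤deg k x S = ∑-nonneg S λ y → 0≤is k (L x y)

  0≤tot : ∀ k S → 0ℤ ≤ tot k S
  0≤tot k S = ∑-nonneg S λ x → 0≤deg k x S

  -- For a fixed apex the count is at most the square of its degree and at most the number of
  -- possible bases. The bound of `min-square-bound` is linear in the degree, so it can be summed
  -- over the apexes.
  ∑-spoke : ∀ k l S → let m = + length S in
    + 4 * (m * ∑₃ S (on (spoke k l))) ≤ tot k S * (+ 4 * tot l S + m * m)
  ∑-spoke k l S = begin
    + 4 * (m * ∑₃ S (on (spoke k l)))                ≡⟨ cong (+ 4 *_) (∑-*ˡ S m apex) ⟨
    + 4 * ∑ S (λ x → m * apex x)                     ≡⟨ ∑-*ˡ S (+ 4) _ ⟨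
    ∑ S (λ x → + 4 * (m * apex x))                   ≤⟨ ∑-mono S (λ x → min-square-bound {m} (0≤deg k x S) (0≤apex x) (square x) (base x)) ⟩
    ∑ S (λ x → deg k x S * (+ 4 * tot l S + m * m))  ≡⟨ ∑-*ʳ S _ _ ⟩
    tot k S * (+ 4 * tot l S + m * m)                ∎
    where
    open ≤-Reasoning
    m = + length S
    apex : A → ℤ
    apex x = ∑₂ S (on (spoke k l) x)
    0≤apex : ∀ x → 0ℤ ≤ apex x
    0≤apex x = ∑-nonneg S λ y → ∑-nonneg S λ z → 0≤is k (L x y) ⊗ 0≤is k (L x z) ⊗ 0≤is l (L y z)
    square : ∀ x → apex x ≤ deg k x S * deg k x S
    square x = ≤-trans
      (∑₂-mono S λ y z → shrinkʳ (0≤is k (L x y) ⊗ 0≤is k (L x z)) (is≤1 l (L y z)))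
      (≤-reflexive (∑₂-* S _ _))
    base : ∀ x → apex x ≤ tot l S
    base x = ∑₂-mono S λ y z → shrinkˡ (0≤is l (L y z))
      (≤-trans (shrinkʳ (0≤is k (L x y)) (is≤1 k (L x z))) (is≤1 k (L x y)))

  -- At each x the count is at most the product of the two cyclic degrees, hence at most a quarter
  -- of the square of their sum, which is itself at most m.
  ∑-rim : ∀ S → + 4 * ∑₃ S (on rim) ≤ + length S * (tot cw S + tot ccw S)
  ∑-rim S = begin
    + 4 * ∑₃ S (on rim)                                 ≡⟨ ∑-*ˡ S (+ 4) _ ⟨
    ∑ S (λ x → + 4 * ∑₂ S (on rim x))                   ≤⟨ ∑-mono S bound ⟩
    ∑ S (λ x → m * (deg cw x S + deg ccw x S))          ≡⟨ ∑-*ˡ S m _ ⟩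
    m * ∑ S (λ x → deg cw x S + deg ccw x S)            ≡⟨ cong (m *_) (∑-+ S _ _) ⟩
    m * (tot cw S + tot ccw S)                          ∎
    where
    open ≤-Reasoning
    m = + length S
    identity : ∀ m a b r → m * (a + b) - + 4 * r ≡
      (m - (a + b)) * (a + b) + (a - b) * (a - b) + + 4 * (a * b - r)
    identity = solve-∀
    bound : ∀ x → + 4 * ∑₂ S (on rim x) ≤ m * (deg cw x S + deg ccw x S)
    bound x = ≤-by _ (identity m (deg cw x S) (deg ccw x S) (∑₂ S (on rim x)))
      (gap cyclic-degree ⊗ (0≤deg cw x S ⊕ 0≤deg ccw x S) ⊕ 0≤sq (deg cw x S - deg ccw x S)
       ⊕ 0≤+ {4} ⊗ gap (≤-trans (∑₂-mono S λ y z → middle (0≤is cw (L x y)) (0≤is ccw (L x z)) (is≤1 cw (L y z)))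
                                  (≤-reflexive (∑₂-* S _ _))))
      where
      cyclic-degree : deg cw x S + deg ccw x S ≤ m
      cyclic-degree = ≤-trans (≤-reflexive (sym (∑-+ S _ _)))
        (≤-trans (∑-mono S λ y → cyclic≤1 (L x y)) (≤-reflexive (∑-one S)))

  tot-inn : ∀ S → tot inn S ≡ tot out S
  tot-inn S = trans (∑-swap S S _) (∑-cong S λ y → ∑-cong S λ x →
    sym (trans (cong (is out) (L-flip x y)) (is-flip (L x y))))

  tot-≤ : ∀ S → let m = + length S in
    tot red S + tot blue S + + 2 * tot out S + (tot cw S + tot ccw S) + m ≤ m * m
  tot-≤ S = subst (_≤ m * m) (cong (_+ m) (begin
    ∑₂ S (λ x y → isPair (L x y))
      ≡⟨ trans (∑₂-+ S _ _) (cong₂ _+_ (trans (∑₂-+ S _ _) (cong₂ _+_ (∑₂-+ S _ _) (∑₂-+ S _ _))) (∑₂-+ S _ _)) ⟩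
    tot red S + tot blue S + (tot out S + tot inn S) + (tot cw S + tot ccw S)
      ≡⟨ cong (λ t → tot red S + tot blue S + (tot out S + t) + (tot cw S + tot ccw S)) (tot-inn S) ⟩
    tot red S + tot blue S + (tot out S + tot out S) + (tot cw S + tot ccw S)
      ≡⟨ cong (λ t → tot red S + tot blue S + t + (tot cw S + tot ccw S)) (double (tot out S)) ⟩
    tot red S + tot blue S + + 2 * tot out S + (tot cw S + tot ccw S) ∎))
    (∑₂-irreflexive-≤ S (λ x → cong isPair (L-diag x)) (λ x y → isPair≤1 (L x y)))
    where
    open ≡-Reasoning
    m = + length S
    double : ∀ a → a + a ≡ + 2 * a
    double = solve-∀

  total-≤ : ∀ S → let m = + length S in
    + 4 * (m * total S) ≤ tot red S * (+ 4 * tot red S + m * m)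
      + + 3 * (tot out S * (+ 4 * tot blue S + m * m)) + + 2 * (m * m * (tot cw S + tot ccw S))
  total-≤ S = ≤-by _
    (trans (cong (λ t → rhs - + 4 * (m * t)) (total-split S))
           (identity m (∑₃ S (on (spoke red red))) (∑₃ S (on (spoke out blue))) (∑₃ S (on rim))
             (tot red S * (+ 4 * tot red S + m * m)) (tot out S * (+ 4 * tot blue S + m * m)) (tot cw S + tot ccw S)))
    (gap (∑-spoke red red S) ⊕ 0≤+ {3} ⊗ gap (∑-spoke out blue S) ⊕ 0≤+ {2} ⊗ (0≤+ {length S} ⊗ gap (∑-rim S)))
    where
    m = + length S
    rhs = tot red S * (+ 4 * tot red S + m * m)
      + + 3 * (tot out S * (+ 4 * tot blue S + m * m)) + + 2 * (m * m * (tot cw S + tot ccw S))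
    identity : ∀ m r h c R H C → R + + 3 * H + + 2 * (m * m * C) - + 4 * (m * (r + + 3 * h + + 2 * c)) ≡
      (R - + 4 * (m * r)) + + 3 * (H - + 4 * (m * h)) + + 2 * (m * (m * C - + 4 * c))
    identity = solve-∀

  module _ {P : A → Set} (S : List A) (p : Any P S) where

    private
      a  = Any.lookup p
      ys = S ─ p

    deg-─ : ∀ k → deg k a S ≡ deg k a ys
    deg-─ k = trans (∑-─ S p _) (trans (cong (_+ deg k a ys) (trans (cong (is k) (L-diag a)) (is-none k))) (+-identityˡ _))

    tot-─ : ∀ k → (∀ l → is k (flip l) ≡ is k l) → tot k S ≡ tot k ys + (deg k a ys + deg k a ys)
    tot-─ k sym-k = trans (∑₂-─ S p _ (trans (cong (is k) (L-diag a)) (is-none k)))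
      (cong (λ s → tot k ys + (deg k a ys + s)) (∑-cong ys λ x → trans (cong (is k) (L-flip a x)) (sym-k (L a x))))

    -- The three positions of the deleted vertex are collected into one double sum over `ys` and
    -- bounded by `vertexCap`.
    total-─ : total S ≤ total ys +
      (+ 3 * (deg red a ys * deg red a ys) + + 3 * (deg out a ys * deg out a ys)
       + + 6 * (deg inn a ys * deg blue a ys) + + 4 * (deg cw a ys * deg ccw a ys) + + 2 * (deg ccw a ys * deg cw a ys))
    total-─ = begin
      total S
        ≡⟨ ∑₃-─ S p (on weight)
             (λ x y → trans (cong (λ l → weight l (L x y) (L x y)) (L-diag x)) (weight-none₁ (L x y) (L x y)))
             (λ x y → trans (cong (weight (L x y) (L y x)) (L-diag x)) (weight-none₃ (L x y) _))
             (λ x y → trans (cong (λ l → weight (L y x) l (L y x)) (L-diag x)) (weight-none₂ (L y x) _)) ⟩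
      total ys + (∑₂ ys (on weight a) + ∑₂ ys (λ x y → on weight x a y) + ∑₂ ys (λ x y → on weight x y a))
        ≡⟨ cong (λ s → total ys + s) (sym (trans (∑₂-+ ys _ _) (cong (_+ ∑₂ ys (λ x y → on weight x y a)) (∑₂-+ ys _ _)))) ⟩
      total ys + ∑₂ ys (λ x y → on weight a x y + on weight x a y + on weight x y a)
        ≤⟨ +-monoʳ-≤ (total ys) (∑₂-mono ys λ x y → subst (_≤ vertexCap (L a x) (L a y))
             (sym (cong₂ (λ s t → on weight a x y + s + t)
               (cong (λ l → weight l (L a y) (L x y)) (L-flip a x))
               (cong₂ (weight (L x y)) (L-flip a y) (L-flip a x))))
             (vertexWeight≤vertexCap (L a x) (L a y) (L x y))) ⟩
      total ys + ∑₂ ys (λ x y → vertexCap (L a x) (L a y))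
        ≡⟨ cong (λ s → total ys + s) cap ⟩
      total ys + (+ 3 * (deg red a ys * deg red a ys) + + 3 * (deg out a ys * deg out a ys)
       + + 6 * (deg inn a ys * deg blue a ys) + + 4 * (deg cw a ys * deg ccw a ys) + + 2 * (deg ccw a ys * deg cw a ys)) ∎
      where
      open ≤-Reasoning
      pair : ∀ c k l → ∑₂ ys (λ x y → c * (is k (L a x) * is l (L a y))) ≡ c * (deg k a ys * deg l a ys)
      pair c k l = trans (∑₂-*ˡ ys c _) (cong (c *_) (∑₂-* ys _ _))
      cap : ∑₂ ys (λ x y → vertexCap (L a x) (L a y)) ≡
        + 3 * (deg red a ys * deg red a ys) + + 3 * (deg out a ys * deg out a ys)
        + + 6 * (deg inn a ys * deg blue a ys) + + 4 * (deg cw a ys * deg ccw a ys) + + 2 * (deg ccw a ys * deg cw a ys)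
      cap = trans (∑₂-+ ys _ _) (cong₂ _+_ (trans (∑₂-+ ys _ _) (cong₂ _+_ (trans (∑₂-+ ys _ _) (cong₂ _+_
        (trans (∑₂-+ ys _ _) (cong₂ _+_ (pair (+ 3) red red) (pair (+ 3) out out)))
        (pair (+ 6) inn blue))) (pair (+ 4) cw ccw))) (pair (+ 2) ccw cw))

    deg-≤ : deg red a ys + deg blue a ys + deg out a ys + deg inn a ys + (deg cw a ys + deg ccw a ys) ≤ + length ys
    deg-≤ = begin
      deg red a ys + deg blue a ys + deg out a ys + deg inn a ys + (deg cw a ys + deg ccw a ys)
        ≡⟨ cong (_+ (deg cw a ys + deg ccw a ys)) (+-assoc (deg red a ys + deg blue a ys) (deg out a ys) (deg inn a ys)) ⟩
      deg red a ys + deg blue a ys + (deg out a ys + deg inn a ys) + (deg cw a ys + deg ccw a ys)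
        ≡⟨ trans (∑-+ ys _ _) (cong₂ _+_ (trans (∑-+ ys _ _) (cong₂ _+_ (∑-+ ys _ _) (∑-+ ys _ _))) (∑-+ ys _ _)) ⟨
      ∑ ys (λ y → isPair (L a y))
        ≤⟨ ∑-mono ys (λ y → isPair≤1 (L a y)) ⟩
      ∑ ys (λ _ → 1ℤ)
        ≡⟨ ∑-one ys ⟩
      + length ys ∎
      where open ≤-Reasoning

  private
    cancel-length : ∀ {k} t → let m = + ℕ.suc k in m * (+ 8 * t) ≤ m * linkBound m → + 8 * t ≤ linkBound m
    cancel-length {k} t = *-cancelˡ-≤-pos (+ 8 * t) (linkBound (+ ℕ.suc k)) (+ ℕ.suc k)

    tot-≤-suc : ∀ S k → length S ≡ ℕ.suc k →
      tot red S + tot blue S + + 2 * tot out S + (tot cw S + tot ccw S) ≤ (1ℤ + + k) * + k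
    tot-≤-suc S k ∣S∣≡1+k = ≤-by _ (identity (+ k) w)
      (gap (subst (λ n → w + + n ≤ + n * + n) ∣S∣≡1+k (tot-≤ S)))
      where
      w = tot red S + tot blue S + + 2 * tot out S + (tot cw S + tot ccw S)
      identity : ∀ q w → (1ℤ + q) * q - w ≡ (1ℤ + q) * (1ℤ + q) - (w + (1ℤ + q))
      identity = solve-∀

    total-≤-suc : ∀ S k → length S ≡ ℕ.suc k → let m = + ℕ.suc k in
      + 4 * (m * total S) ≤ tot red S * (+ 4 * tot red S + m * m)
        + + 3 * (tot out S * (+ 4 * tot blue S + m * m)) + + 2 * (m * m * (tot cw S + tot ccw S))
    total-≤-suc S k ∣S∣≡1+k = subst (λ n → let m = + n in
      + 4 * (m * total S) ≤ tot red S * (+ 4 * tot red S + m * m)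
        + + 3 * (tot out S * (+ 4 * tot blue S + m * m)) + + 2 * (m * m * (tot cw S + tot ccw S)))
      ∣S∣≡1+k (total-≤ S)

  -- Since `out` and `inn` have equal totals, R ≤ B yields on average a vertex with red + out ≤ inn
  -- + blue. That vertex is deleted; either R ≤ B persists and induction applies, or the sign
  -- changes and `S` itself is nearly balanced.
  total-≤-sparse : ∀ k S → length S ≡ k → tot red S ≤ tot blue S → + 8 * total S ≤ linkBound (+ k)
  total-≤-sparse ℕ.zero    []         _    _   = ≤-refl
  total-≤-sparse (ℕ.suc k) S@(x ∷ xs) ∣S∣ R≤B with ∑-≤⇒Any x xs
    {λ a → deg red a S + deg out a S} {λ a → deg inn a S + deg blue a S}
    (subst₂ _≤_ (sym (trans (∑-+ S (λ a → deg red a S) (λ a → deg out a S)) (+-comm (tot red S) (tot out S))))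
       (sym (trans (∑-+ S (λ a → deg inn a S) (λ a → deg blue a S)) (cong (_+ tot blue S) (tot-inn S)))) (+-monoʳ-≤ (tot out S) R≤B))
  ... | p = conclude (≤-total (tot red ys) (tot blue ys))
    where
    a  = Any.lookup p
    ys = S ─ p
    r = deg red a ys
    b = deg blue a ys
    u = deg out a ys
    i = deg inn a ys
    c = deg cw a ys
    c′ = deg ccw a ys
    q = + k

    ∣ys∣ : length ys ≡ k
    ∣ys∣ = ℕ.suc-injective (trans (sym (length-─ S p)) ∣S∣)

    row : r + b + u + i + (c + c′) ≤ q
    row = subst (λ n → _ ≤ + n) ∣ys∣ (deg-≤ S p)

    low-degree : + 2 * (r * r) + + 2 * (u * u) + + 4 * (i * b) + (c + c′) * (c + c′) ≤ q * q
    low-degree = vertex-bound (0≤deg red a ys) (0≤deg blue a ys) (0≤deg out a ys) (0≤deg inn a ys)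
      (0≤deg cw a ys ⊕ 0≤deg ccw a ys)
      -- The averaged inequality concerns degrees in `S`; they equal those in `ys` because `a` has
      -- label `none` to itself.
      (subst₂ _≤_ (cong₂ _+_ (deg-─ S p red) (deg-─ S p out)) (cong₂ _+_ (deg-─ S p inn) (deg-─ S p blue))
        (lookup-result p))
      row

    conclude : tot red ys ≤ tot blue ys ⊎ tot blue ys ≤ tot red ys → + 8 * total S ≤ linkBound (+ ℕ.suc k)
    -- `linkBound` grows by 12q² + 24q + 14 from q to q + 1. The first term pays for 12 times
    -- `low-degree`, using 48cc′ = 12(c + c′)² - 12(c - c′)².
    conclude (inj₁ R′≤B′) = ≤-by _ (identity q (total S) (total ys) r u i b c c′)
      (0≤+ {8} ⊗ gap (total-─ S p) ⊕ gap (total-≤-sparse k ys ∣ys∣ R′≤B′) ⊕ 0≤+ {12} ⊗ gap low-degree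
       ⊕ 0≤+ {12} ⊗ 0≤sq (c - c′) ⊕ (0≤+ {24} ⊗ 0≤+ {k} ⊕ 0≤+ {14}))
      where
      identity : ∀ q t t′ r u i b c c′ → let m = 1ℤ + q in
        + 4 * (m * m * m) + + 6 * (m * m) + + 4 * m - + 8 * t ≡
        + 8 * (t′ + (+ 3 * (r * r) + + 3 * (u * u) + + 6 * (i * b) + + 4 * (c * c′) + + 2 * (c′ * c)) - t)
        + (+ 4 * (q * q * q) + + 6 * (q * q) + + 4 * q - + 8 * t′)
        + + 12 * (q * q - (+ 2 * (r * r) + + 2 * (u * u) + + 4 * (i * b) + (c + c′) * (c + c′)))
        + + 12 * ((c - c′) * (c - c′)) + (+ 24 * q + + 14)
      identity = solve-∀
    -- Here B - R ≤ 2b - 2r ≤ 2q, so `crossing-bound` applies to `S` before the deletion.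
    conclude (inj₂ B′≤R′) = cancel-length (total S)
      (crossing-bound (0≤+ {k}) (0≤tot red S) (0≤tot blue S) (0≤tot out S) (0≤tot cw S ⊕ 0≤tot ccw S)
        (tot-≤-suc S k ∣S∣) (total-≤-suc S k ∣S∣) R≤B excess)
      where
      identity : ∀ q R B r b rest → + 2 * q - (B + (b + b) - (R + (r + r))) ≡
        + 2 * (q - (r + b + rest)) + (R - B) + + 4 * r + + 2 * rest
      identity = solve-∀
      reassoc : ∀ r b u i c → r + b + (u + i + c) ≡ r + b + u + i + c
      reassoc = solve-∀
      excess : tot blue S - tot red S ≤ + 2 * q
      excess = ≤-by _
        (trans (cong₂ (λ s t → + 2 * q - (s - t)) (tot-─ S p blue is-blue-flip) (tot-─ S p red is-red-flip))
               (identity q (tot red ys) (tot blue ys) r b (u + i + (c + c′))))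
        (0≤+ {2} ⊗ gap (subst (_≤ q) (sym (reassoc r b u i (c + c′))) row) ⊕ gap B′≤R′ ⊕ 0≤+ {4} ⊗ 0≤deg red a ys
         ⊕ 0≤+ {2} ⊗ (0≤deg out a ys ⊕ 0≤deg inn a ys ⊕ (0≤deg cw a ys ⊕ 0≤deg ccw a ys)))

  link-bound : ∀ S → tot red S ≤ tot out S → + 8 * ∑₃ S (on patterns) ≤ linkBound (+ length S)
  link-bound S R≤U = subst (λ t → + 8 * t ≤ linkBound (+ length S)) (sym (∑-patterns S))
    (bound S R≤U (≤-total (tot red S) (tot blue S)))
    where
    bound : ∀ S → tot red S ≤ tot out S → tot red S ≤ tot blue S ⊎ tot blue S ≤ tot red S → + 8 * total S ≤ linkBound (+ length S)
    bound S R≤U (inj₁ R≤B) = total-≤-sparse (length S) S refl R≤B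
    -- The empty list is separate because its length 0 cannot be cancelled.
    bound []         R≤U (inj₂ B≤R) = ≤-refl
    bound S@(_ ∷ xs) R≤U (inj₂ B≤R) = cancel-length (total S)
      (few-blue-bound (0≤+ {length xs}) (0≤tot red S) (0≤tot blue S) (0≤tot out S) (0≤tot cw S ⊕ 0≤tot ccw S)
        (tot-≤-suc S (length xs) refl) (total-≤-suc S (length xs) refl) R≤U B≤R)

-- Labels from a two-colouring of ordered triples

all𝔹? : ∀ {P : Bool → Set} → Decidable P → Dec (∀ b → P b)
all𝔹? P? = map′ (λ (f , t) → λ where false → f; true → t) (λ p → p false , p true) (P? false ×-dec P? true)

data Minority : Set where
  tie first second third : Minority

-- Locates the bit that differs from the other two; `tie` means that all three are equal.
minority : Bool → Bool → Bool → Minority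
minority x y z = if x xor y then (if y xor z then second else first) else (if y xor z then third else tie)

agree : Bool → Bool → Bool
agree x y = not (x xor y)

-- The first argument compares, over the middle vertices a, b, d, whether reversal preserves the
-- colour. If one vertex behaves differently, it fixes the label. If reversal acts alike at all
-- three, the minority among the colours decides, and in the fully symmetric case without agreement
-- the colour itself gives the cyclic direction.
classify : Minority → Bool → Minority → Bool → Label
classify tie    true  tie    _     = blue
classify tie    true  first  _     = out
classify tie    true  second _     = inn
classify tie    true  third  _     = red
classify tie    false tie    false = ccw
classify tie    false tie    true  = cw
classify tie    false first  _     = inn
classify tie    false second _     = out
classify tie    false third  _     = blue
classify first  _     _      _     = inn
classify second _     _      _     = out
classify third  _     _      _     = blue

-- The arguments are the colours of dab, abd, bda and of their reversals bad, dba,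
-- adb, so that the indices 1, 2, 3 stand for the middle vertices a, b, d.
bitsLabel : (x₁ x₂ x₃ y₁ y₂ y₃ : Bool) → Label
bitsLabel x₁ x₂ x₃ y₁ y₂ y₃ =
  classify (minority (agree x₁ y₁) (agree x₂ y₂) (agree x₃ y₃)) (agree x₁ y₁) (minority x₁ x₂ x₃) x₁

-- An injection into ℕ with left inverse `decode`, used to transfer decidable equality to labels.
code : Label → ℕ
code none = 0
code red  = 1
code blue = 2
code out  = 3
code inn  = 4
code cw   = 5
code ccw  = 6

decode : ℕ → Label
decode 1 = red
decode 2 = blue
decode 3 = out
decode 4 = inn
decode 5 = cw
decode 6 = ccw
decode _ = none

decode-code : ∀ l → decode (code l) ≡ l
decode-code none = refl
decode-code red  = refl
decode-code blue = refl
decode-code out  = refl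
decode-code inn  = refl
decode-code cw   = refl
decode-code ccw  = refl

infix 4 _≟ᴸ_
_≟ᴸ_ : DecidableEquality Label
k ≟ᴸ l = map′ (λ eq → trans (sym (decode-code k)) (trans (cong decode eq) (decode-code l))) (cong code) (code k ℕ.≟ code l)

bitsLabel-flip : ∀ x₁ x₂ x₃ y₁ y₂ y₃ → bitsLabel y₂ y₁ y₃ x₂ x₁ x₃ ≡ flip (bitsLabel x₁ x₂ x₃ y₁ y₂ y₃)
bitsLabel-flip = from-yes (all𝔹? λ x₁ → all𝔹? λ x₂ → all𝔹? λ x₃ → all𝔹? λ y₁ → all𝔹? λ y₂ → all𝔹? λ y₃ →
  bitsLabel y₂ y₁ y₃ x₂ x₁ x₃ ≟ᴸ flip (bitsLabel x₁ x₂ x₃ y₁ y₂ y₃))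

-- Red for ab in the link of d means that all reversals agree and d is the odd middle vertex. In the
-- link of a the odd vertex d is the tail of the arrow d → b; the right-hand bits are those of a, d,
-- b.
bitsLabel-red⇒out : ∀ x₁ x₂ x₃ y₁ y₂ y₃ →
  is red (bitsLabel x₁ x₂ x₃ y₁ y₂ y₃) ≤ is out (bitsLabel y₃ y₂ y₁ x₃ x₂ x₁)
bitsLabel-red⇒out = from-yes (all𝔹? λ x₁ → all𝔹? λ x₂ → all𝔹? λ x₃ → all𝔹? λ y₁ → all𝔹? λ y₂ → all𝔹? λ y₃ →
  is red (bitsLabel x₁ x₂ x₃ y₁ y₂ y₃) ≤? is out (bitsLabel y₃ y₂ y₁ x₃ x₂ x₁))

-- For an edge dabc the colours of dab determine those of dbc and dac, as substituted in the second
-- and third labels. The 64 cases are then evaluated.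
bitsLabel-pattern : ∀ x₁ x₂ x₃ y₁ y₂ y₃ → 1ℤ ≤ patterns (bitsLabel x₁ x₂ x₃ y₁ y₂ y₃)
  (bitsLabel (not y₃) x₁ (not y₂) (not x₃) y₁ (not x₂)) (bitsLabel (not x₃) y₂ (not x₁) (not y₃) x₂ (not y₁))
bitsLabel-pattern = from-yes (all𝔹? λ x₁ → all𝔹? λ x₂ → all𝔹? λ x₃ → all𝔹? λ y₁ → all𝔹? λ y₂ → all𝔹? λ y₃ →
  1ℤ ≤? patterns (bitsLabel x₁ x₂ x₃ y₁ y₂ y₃)
    (bitsLabel (not y₃) x₁ (not y₂) (not x₃) y₁ (not x₂)) (bitsLabel (not x₃) y₂ (not x₁) (not y₃) x₂ (not y₁)))

𝟙 : Bool → ℤ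
𝟙 false = 0ℤ
𝟙 true  = 1ℤ

0≤𝟙 : ∀ b → 0ℤ ≤ 𝟙 b
0≤𝟙 = from-yes (all𝔹? λ b → 0ℤ ≤? 𝟙 b)

-- Links under a colouring of ordered triples, and induction on the vertices

module _ {A : Set} (_≟_ : DecidableEquality A) (E : A → A → A → A → Bool)
  (E-irrefl : ∀ a b c → E a a b c ≡ false)
  (E-swap₁₂ : ∀ a b c d → E b a c d ≡ E a b c d)
  (E-swap₂₃ : ∀ a b c d → E a c b d ≡ E a b c d)
  (E-swap₃₄ : ∀ a b c d → E a b d c ≡ E a b c d)
  (col : A → A → A → Bool)
  (col-step : ∀ a b c d → E a b c d ≡ true → col b c d ≡ not (col a b c))
  where

  private
    s₁₂ : ∀ {a b c d} → E a b c d ≡ true → E b a c d ≡ true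
    s₁₂ = trans (E-swap₁₂ _ _ _ _)
    s₂₃ : ∀ {a b c d} → E a b c d ≡ true → E a c b d ≡ true
    s₂₃ = trans (E-swap₂₃ _ _ _ _)
    s₃₄ : ∀ {a b c d} → E a b c d ≡ true → E a b d c ≡ true
    s₃₄ = trans (E-swap₃₄ _ _ _ _)

    step : ∀ {a b c d} → E a b c d ≡ true → col b c d ≡ not (col a b c)
    step = col-step _ _ _ _

    step² : ∀ {a b c d} → E a b c d ≡ true → E b c d a ≡ true → col c d a ≡ col a b c
    step² e e′ = trans (step e′) (trans (cong not (step e)) (not-involutive _))

  tripleLabel : A → A → A → Label
  tripleLabel d a b = bitsLabel (col d a b) (col a b d) (col b d a) (col b a d) (col d b a) (col a d b)

  -- Every ordering of dbc is one or two tight steps away from an ordering of dab: one step negates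
  -- the colour and two preserve it.
  tripleLabel-next : ∀ {d a b c} → E d a b c ≡ true → tripleLabel d b c ≡
    bitsLabel (not (col a d b)) (col d a b) (not (col d b a)) (not (col b d a)) (col b a d) (not (col a b d))
  tripleLabel-next {d} {a} {b} {c} e = next (s₃₄ (s₁₂ (s₂₃ (s₃₄ e))))
    where
    next : E c d b a ≡ true → tripleLabel d b c ≡
      bitsLabel (not (col a d b)) (col d a b) (not (col d b a)) (not (col b d a)) (col b a d) (not (col a b d))
    next e′
      rewrite step (s₁₂ e)
            | step² e (s₃₄ (s₂₃ (s₁₂ e)))
            -- This step and the next start at an ordering of dbc, so their equations are solved for
            -- the colour of the source.
            | trans (sym (not-involutive (col c d b))) (cong not (sym (step e′)))
            | trans (sym (not-involutive (col c b d))) (cong not (sym (step (s₂₃ e′))))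
            | sym (step² (s₁₂ e′) (s₃₄ (s₂₃ e′)))
            | step (s₂₃ (s₁₂ e)) = refl

  tripleLabel-pattern : ∀ {d a b c} → E d a b c ≡ true →
    1ℤ ≤ patterns (tripleLabel d a b) (tripleLabel d b c) (tripleLabel d a c)
  tripleLabel-pattern {d} {a} {b} {c} e =
    subst₂ (λ k l → 1ℤ ≤ patterns (tripleLabel d a b) k l) (sym (tripleLabel-next e)) (sym (tripleLabel-next (s₂₃ e)))
      (bitsLabel-pattern (col d a b) (col a b d) (col b d a) (col b a d) (col d b a) (col a d b))

  select : ∀ {P Q R : Set} → Dec P → Dec Q → Dec R → Label → Label
  select (no _) (no _) (no _) l = l
  select _      _      _      _ = none

  select-≢ : ∀ {P Q R : Set} (p : Dec P) (q : Dec Q) (r : Dec R) l → ¬ P → ¬ Q → ¬ R → select p q r l ≡ l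
  select-≢ (yes p) _       _       l ¬p ¬q ¬r = contradiction p ¬p
  select-≢ (no _)  (yes q) _       l ¬p ¬q ¬r = contradiction q ¬q
  select-≢ (no _)  (no _)  (yes r) l ¬p ¬q ¬r = contradiction r ¬r
  select-≢ (no _)  (no _)  (no _)  l ¬p ¬q ¬r = refl

  -- Degenerate triples get `none`; thus a vertex list containing d can serve as the ground set of
  -- the link of d.
  pairLabel : A → A → A → Label
  pairLabel d a b = select (d ≟ a) (d ≟ b) (a ≟ b) (tripleLabel d a b)

  pairLabel-≢ : ∀ {d a b} → d ≢ a → d ≢ b → a ≢ b → pairLabel d a b ≡ tripleLabel d a b
  pairLabel-≢ {d} {a} {b} = select-≢ (d ≟ a) (d ≟ b) (a ≟ b) (tripleLabel d a b)

  pairLabel-diag : ∀ d a → pairLabel d a a ≡ none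
  pairLabel-diag d a with d ≟ a | a ≟ a
  ... | yes _ | _      = refl
  ... | no _  | yes _  = refl
  ... | no _  | no a≢a = contradiction refl a≢a

  pairLabel-diagˡ : ∀ d a → pairLabel d d a ≡ none
  pairLabel-diagˡ d a with d ≟ d
  ... | yes _  = refl
  ... | no d≢d = contradiction refl d≢d

  pairLabel-flip : ∀ d a b → pairLabel d b a ≡ flip (pairLabel d a b)
  pairLabel-flip d a b with d ≟ a | d ≟ b | a ≟ b | b ≟ a
  ... | yes _ | yes _ | _      | _      = refl
  ... | yes _ | no _  | _      | _      = refl
  ... | no _  | yes _ | _      | _      = refl
  ... | no _  | no _  | yes _  | yes _  = refl
  ... | no _  | no _  | yes ab | no b≢a = contradiction (sym ab) b≢a
  ... | no _  | no _  | no a≢b | yes ba = contradiction (sym ba) a≢b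
  ... | no _  | no _  | no _   | no _   =
    bitsLabel-flip (col d a b) (col a b d) (col b d a) (col b a d) (col d b a) (col a d b)

  pairLabel-red⇒out : ∀ d a b → is red (pairLabel d a b) ≤ is out (pairLabel a d b)
  pairLabel-red⇒out d a b = red-select (d ≟ a) (d ≟ b) (a ≟ b) (0≤is out (pairLabel a d b))
    λ d≢a d≢b a≢b → subst (λ l → is red (tripleLabel d a b) ≤ is out l)
      (sym (pairLabel-≢ (d≢a ∘ sym) a≢b d≢b))
      (bitsLabel-red⇒out (col d a b) (col a b d) (col b d a) (col b a d) (col d b a) (col a d b))
    where
    red-select : ∀ {P Q R : Set} (p : Dec P) (q : Dec Q) (r : Dec R) {l i} → 0ℤ ≤ i →
      (¬ P → ¬ Q → ¬ R → is red l ≤ i) → is red (select p q r l) ≤ i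
    red-select (yes _) _       _       0≤i _ = 0≤i
    red-select (no _)  (yes _) _       0≤i _ = 0≤i
    red-select (no _)  (no _)  (yes _) 0≤i _ = 0≤i
    red-select (no ¬p) (no ¬q) (no ¬r) 0≤i f = f ¬p ¬q ¬r

  E-≢ : ∀ {a b c d} → E a b c d ≡ true → a ≢ b
  E-≢ {a} {.a} {c} {d} e refl with () ← trans (sym e) (E-irrefl a c d)

  open module Link-of d = Labelling (pairLabel d) (pairLabel-flip d) (pairLabel-diag d) using (on; tot; link-bound)

  E-pattern : ∀ d a b c → 𝟙 (E d a b c) ≤ on d patterns a b c
  E-pattern d a b c with E d a b c in e
  ... | false = 0≤patterns (pairLabel d a b) (pairLabel d b c) (pairLabel d a c)
  ... | true  rewrite pairLabel-≢ (E-≢ e) (E-≢ (s₂₃ e)) (E-≢ (s₂₃ (s₁₂ e)))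
                    | pairLabel-≢ (E-≢ (s₂₃ e)) (E-≢ (s₂₃ (s₃₄ e))) (E-≢ (s₂₃ (s₁₂ (s₃₄ (s₂₃ (s₁₂ e))))))
                    | pairLabel-≢ (E-≢ e) (E-≢ (s₂₃ (s₃₄ e))) (E-≢ (s₂₃ (s₁₂ (s₃₄ e)))) = tripleLabel-pattern e

  degree-bound : ∀ d S → tot d red S ≤ tot d out S → + 8 * ∑₃ S (λ x y z → 𝟙 (E d x y z)) ≤ linkBound (+ length S)
  degree-bound d S R≤U = ≤-trans
    (*-monoˡ-≤-nonNeg (+ 8) (∑₃-mono S (E-pattern d)))
    (link-bound d S R≤U)

  -- Summing `pairLabel-red⇒out` over all triples and averaging yields d with R ≤ U in its link.
  -- Deleting d loses 4X ordered edges, X being the ordered triples in its link, and 8X ≤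
  -- `linkBound k` is the increment of n⁴ - n. The summand n later makes the inequality strict.
  edge-bound : ∀ k S → length S ≡ k → let n = + k in
    + 2 * ∑₄ S (λ a b c d → 𝟙 (E a b c d)) + n ≤ n * n * n * n
  edge-bound ℕ.zero    []         _   = ≤-refl
  edge-bound (ℕ.suc k) S@(x ∷ xs) ∣S∣ with ∑-≤⇒Any x xs {λ d → tot d red S} {λ d → tot d out S}
    (≤-trans (∑₃-mono S pairLabel-red⇒out) (≤-reflexive (∑₃-swap₁₂ S λ d a b → is out (pairLabel d a b))))
  ... | p = ≤-by _
    (trans (cong (λ s → m * m * m * m - (+ 2 * s + m)) N-─) (identity (+ k) (∑₄ ys 𝟙E) (∑₃ ys (𝟙E d))))
    (gap (edge-bound k ys ∣ys∣) ⊕ gap (subst (λ n → + 8 * ∑₃ ys (𝟙E d) ≤ linkBound (+ n)) ∣ys∣ (degree-bound d ys R≤U)))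
    where
    m = + ℕ.suc k
    d  = Any.lookup p
    ys = S ─ p
    𝟙E : A → A → A → A → ℤ
    𝟙E a b c d = 𝟙 (E a b c d)
    ∣ys∣ : length ys ≡ k
    ∣ys∣ = ℕ.suc-injective (trans (sym (length-─ S p)) ∣S∣)
    -- Pairs containing d are unlabelled in its own link, so the inequality found on `S` passes to
    -- `ys`.
    tot-─ : ∀ k → tot d k S ≡ tot d k ys
    tot-─ k = begin
      tot d k S
        ≡⟨ ∑₂-─ S p _ (is-none′ (pairLabel-diag d d)) ⟩
      tot d k ys + (∑ ys (λ y → is k (pairLabel d d y)) + ∑ ys (λ y → is k (pairLabel d y d)))
        ≡⟨ cong (λ s → tot d k ys + s) (cong₂ _+_
             (zeros λ y → is-none′ (pairLabel-diagˡ d y))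
             (zeros λ y → is-none′ (trans (pairLabel-flip d d y) (cong flip (pairLabel-diagˡ d y))))) ⟩
      tot d k ys + 0ℤ
        ≡⟨ +-identityʳ _ ⟩
      tot d k ys ∎
      where
      open ≡-Reasoning
      is-none′ : ∀ {l} → l ≡ none → is k l ≡ 0ℤ
      is-none′ refl = is-none k
      zeros : ∀ {f : A → ℤ} → (∀ y → f y ≡ 0ℤ) → ∑ ys f ≡ 0ℤ
      zeros f≡0 = trans (∑-cong ys f≡0) (∑-zero ys)
    R≤U : tot d red ys ≤ tot d out ys
    R≤U = subst₂ _≤_ (tot-─ red) (tot-─ out) (lookup-result p)
    13-irrefl : ∀ x y z → E x y x z ≡ false
    13-irrefl x y z = trans (E-swap₂₃ x x y z) (E-irrefl x y z)
    14-irrefl : ∀ x y z → E x y z x ≡ false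
    14-irrefl x y z = trans (E-swap₃₄ x y x z) (13-irrefl x y z)
    -- By the symmetry of `E` all four positions of d give the same triple sum.
    N-─ : ∑₄ S 𝟙E ≡ ∑₄ ys 𝟙E + (∑₃ ys (𝟙E d) + ∑₃ ys (𝟙E d) + ∑₃ ys (𝟙E d) + ∑₃ ys (𝟙E d))
    N-─ = trans
      (∑₄-─ S p 𝟙E (λ x y z → cong 𝟙 (E-irrefl x y z)) (λ x y z → cong 𝟙 (13-irrefl x y z))
        (λ x y z → cong 𝟙 (14-irrefl x y z))
        (λ x y z → cong 𝟙 (trans (E-swap₁₂ y x y z) (13-irrefl y x z)))
        (λ x y z → cong 𝟙 (trans (E-swap₁₂ y x z y) (14-irrefl y x z)))
        (λ x y z → cong 𝟙 (trans (E-swap₂₃ x z y z) (trans (E-swap₁₂ z x y z) (14-irrefl z x y)))))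
      (cong (λ s → ∑₄ ys 𝟙E + s) (cong₂ _+_ (cong₂ _+_ (cong (λ s → ∑₃ ys (𝟙E d) + s)
        (∑₃-cong ys λ x y z → cong 𝟙 (E-swap₁₂ d x y z)))
        (∑₃-cong ys λ x y z → cong 𝟙 (trans (E-swap₂₃ x d y z) (E-swap₁₂ d x y z))))
        (∑₃-cong ys λ x y z → cong 𝟙 (trans (E-swap₃₄ x y d z) (trans (E-swap₂₃ x d y z) (E-swap₁₂ d x y z))))))
    identity : ∀ q N X → let m = 1ℤ + q in
      m * m * m * m - (+ 2 * (N + (X + X + X + X)) + m) ≡
      (q * q * q * q - (+ 2 * N + q)) + (+ 4 * (q * q * q) + + 6 * (q * q) + + 4 * q - + 8 * X)
    identity = solve-∀

-- Parity of tight walks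

module _ {S : Set} (_≟_ : DecidableEquality S) (W : Bool → S → S → Set)
  (W-refl : ∀ {x} → W false x x) (W-sym : ∀ {p x y} → W p x y → W p y x)
  (W-trans : ∀ {p q x y z} → W p x y → W q y z → W (p xor q) x z)
  (no-odd : ∀ {x} → ¬ W true x x)
  where

  private
    -- comp is constant along the given pairs, and vertices with the same value
    -- of comp are joined by a walk whose parity is read off col.
    record Components (L : List (S × S)) : Set where
      field
        comp    : S → S
        col     : S → Bool
        joined  : ∀ x y → comp x ≡ comp y → W (col x xor col y) x y
        proper  : All (λ (x , y) → comp x ≡ comp y × col y ≡ not (col x)) L

    module _ {L} (C : Components L) (s t : S) (st : W true s t) where
      open Components C

      -- If s and t had the same colour, the even walk joining them would close up with the odd walk
      -- `st` to an odd closed walk at s.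
      within : comp s ≡ comp t → Components ((s , t) ∷ L)
      within s~t = record { comp = comp ; col = col ; joined = joined ; proper = (s~t , opposite (col s) (col t) (W-trans (joined s t s~t) (W-sym st))) ∷ proper }
        where
        opposite : ∀ b c → W ((b xor c) xor true) s s → c ≡ not b
        opposite true  true  w = contradiction w no-odd
        opposite true  false w = refl
        opposite false true  w = refl
        opposite false false w = contradiction w no-odd

      -- The class of s is absorbed into that of t, and recoloured as a whole if necessary; walks
      -- between the two old classes pass through s and t.
      across : comp s ≢ comp t → Components ((s , t) ∷ L)
      across s≁t = record { comp = comp′ ; col = col′ ; joined = joined′ ; proper = new ∷ All.map old proper }
        where
        -- True exactly when s and t have equal colours, so that the class of s must be inverted.
        shift-by : Bool
        shift-by = not (col s xor col t)
        comp′ : S → S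
        comp′ x with comp x ≟ comp s
        ... | yes _ = comp t
        ... | no _  = comp x
        col′ : S → Bool
        col′ x with comp x ≟ comp s
        ... | yes _ = col x xor shift-by
        ... | no _  = col x
        both : ∀ b c d → (b xor d) xor (c xor d) ≡ b xor c
        both = from-yes (all𝔹? λ b → all𝔹? λ c → all𝔹? λ d → (b xor d) xor (c xor d) Bool.≟ b xor c)
        one : ∀ b c d e → (b xor c) xor (true xor (d xor e)) ≡ (b xor not (c xor d)) xor e
        one = from-yes (all𝔹? λ b → all𝔹? λ c → all𝔹? λ d → all𝔹? λ e →
          (b xor c) xor (true xor (d xor e)) Bool.≟ (b xor not (c xor d)) xor e)
        bridge : ∀ x y → comp x ≡ comp s → comp t ≡ comp y → W ((col x xor shift-by) xor col y) x y
        bridge x y x~s t~y = subst (λ p → W p x y) (one (col x) (col s) (col t) (col y))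
          (W-trans (joined x s x~s) (W-trans st (joined t y t~y)))
        joined′ : ∀ x y → comp′ x ≡ comp′ y → W (col′ x xor col′ y) x y
        joined′ x y eq with comp x ≟ comp s | comp y ≟ comp s
        ... | yes x~s | yes y~s = subst (λ p → W p x y) (sym (both (col x) (col y) shift-by)) (joined x y (trans x~s (sym y~s)))
        ... | yes x~s | no _    = bridge x y x~s eq
        ... | no _    | yes y~s = subst (λ p → W p x y) (xor-comm (col y xor shift-by) (col x)) (W-sym (bridge y x y~s (sym eq)))
        ... | no _    | no _    = joined x y eq
        old : ∀ {(x , y) : S × S} → comp x ≡ comp y × col y ≡ not (col x) → comp′ x ≡ comp′ y × col′ y ≡ not (col′ x)
        old {x , y} (x~y , opp) with comp x ≟ comp s | comp y ≟ comp s
        ... | yes _   | yes _   = refl , trans (cong (_xor shift-by) opp) (sym (not-distribˡ-xor (col x) shift-by))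
        ... | yes x~s | no y≁s  = contradiction (trans (sym x~y) x~s) y≁s
        ... | no x≁s  | yes y~s = contradiction (trans x~y y~s) x≁s
        ... | no _    | no _    = x~y , opp
        flipped : ∀ b c → c ≡ not (b xor not (b xor c))
        flipped = from-yes (all𝔹? λ b → all𝔹? λ c → c Bool.≟ not (b xor not (b xor c)))
        new : comp′ s ≡ comp′ t × col′ t ≡ not (col′ s)
        new with comp s ≟ comp s | comp t ≟ comp s
        ... | no s≁s | _       = contradiction refl s≁s
        ... | yes _  | yes t~s = contradiction (sym t~s) s≁t
        ... | yes _  | no _    = refl , flipped (col s) (col t)

    components : ∀ L → All (λ (x , y) → W true x y) L → Components L
    components []            []       = record
      { comp = id ; col = const false ; joined = λ { x .x refl → W-refl } ; proper = [] }
    components ((s , t) ∷ L) (st ∷ w) with components L w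
    ... | C with Components.comp C s ≟ Components.comp C t
    ...   | yes s~t = within C s t st s~t
    ...   | no s≁t  = across C s t st s≁t

  -- Bipartiteness from the absence of odd closed walks, with the listed pairs inserted one at a
  -- time.
  two-colouring : ∀ L → All (λ (x , y) → W true x y) L → Σ[ col ∈ (S → Bool) ] All (λ (x , y) → col y ≡ not (col x)) L
  two-colouring L w = col , All.map proj₂ proper
    where open Components (components L w)

odd : ℕ → Bool
odd zero    = false
odd (suc n) = not (odd n)

odd-+ : ∀ m n → odd (m ℕ.+ n) ≡ odd m xor odd n
odd-+ zero    n = refl
odd-+ (suc m) n = trans (cong not (odd-+ m n)) (not-distribˡ-xor (odd m) (odd n))

odd⇒1+2* : ∀ n → odd n ≡ true → ∃[ j ] n ≡ 1 ℕ.+ j ℕ.* 2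
odd⇒1+2* 1             _   = 0 , refl
odd⇒1+2* (suc (suc n)) odd with odd⇒1+2* n (trans (sym (not-involutive _)) odd)
... | j , refl = suc j , refl

-- Tight walks, and closed walks as periodic sequences

module TightWalk {A : Set} (E : A → A → A → A → Set) (rotate : ∀ {a b c d} → E a b c d → E b c d a) where

  State : Set
  State = A × A × A

  data Walk : ℕ → State → State → Set where
    stop : ∀ {s} → Walk 0 s s
    step : ∀ {k a b c d t} → E a b c d → Walk k (b , c , d) t → Walk (suc k) (a , b , c) t

  _++_ : ∀ {k l s t u} → Walk k s t → Walk l t u → Walk (k ℕ.+ l) s u
  stop     ++ w′ = w′
  step e w ++ w′ = step e (w ++ w′)

  ParityWalk : Bool → State → State → Set
  ParityWalk p s t = ∃[ k ] odd k ≡ p × Walk k s t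

  parity-trans : ∀ {p q s t u} → ParityWalk p s t → ParityWalk q t u → ParityWalk (p xor q) s u
  parity-trans (k , refl , w) (l , refl , w′) = k ℕ.+ l , odd-+ k l , w ++ w′

  -- A step abc → bcd is undone by the three steps bcd → cda → dab → abc.
  parity-sym : ∀ {p s t} → ParityWalk p s t → ParityWalk p t s
  parity-sym (zero , refl , stop) = 0 , refl , stop
  parity-sym {s = s} {t} (suc k , refl , step e w) = subst (λ p → ParityWalk p t s) (xor-comm (odd k) true)
    (parity-trans (parity-sym (k , refl , w))
      (3 , refl , step (rotate e) (step (rotate (rotate e)) (step (rotate (rotate (rotate e))) stop))))

  module _ {k s} (w₀ : Walk (suc k) s s) where

    private
      -- A place on the closed walk is stored as the nonempty walk still to be traversed to the base
      -- point, so advancing is pattern matching.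
      Position : Set
      Position = ∃[ j ] ∃[ t ] Walk (suc j) t s

      next : Position → Position
      -- The last remaining step ends at `s`, where the whole walk `w₀` begins again.
      next (zero  , _ , _)        = k , s , w₀
      next (suc j , _ , step e w) = j , _ , w

      iterate : ℕ → Position → Position
      iterate zero    x = x
      iterate (suc i) x = iterate i (next x)

      iterate-+ : ∀ i j x → iterate (i ℕ.+ j) x ≡ iterate j (iterate i x)
      iterate-+ zero    j x = refl
      iterate-+ (suc i) j x = iterate-+ i j (next x)

      iterate-return : ∀ j t (w : Walk (suc j) t s) → iterate (suc j) (j , t , w) ≡ (k , s , w₀)
      iterate-return zero    t w          = refl
      iterate-return (suc j) t (step e w) = iterate-return j _ w

      state : Position → State
      state (_ , t , _) = t

      state-next : ∀ x → let (a , b , c) = state x in ∃[ d ] E a b c d × state (next x) ≡ (b , c , d)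
      state-next (zero  , _ , step e stop) = _ , e , refl
      state-next (suc j , _ , step e w)    = _ , e , refl

      position : ℕ → Position
      position i = iterate i (k , s , w₀)

      position-suc : ∀ i → position (suc i) ≡ next (position i)
      position-suc i = trans (cong position (ℕ.+-comm 1 i)) (iterate-+ i 1 _)

      vertex : ℕ → A
      vertex i = proj₁ (state (position i))

      -- Consecutive states overlap in two entries, also across the restart. Hence the state at i
      -- consists of the vertices at i, i + 1 and i + 2.
      state-suc : ∀ i → let (a , b , c) = state (position i) in ∃[ d ] E a b c d × state (position (suc i)) ≡ (b , c , d)
      state-suc i rewrite position-suc i = state-next (position i)

      vertex-2 : ∀ i → vertex (1 ℕ.+ i) ≡ proj₁ (proj₂ (state (position i)))
      vertex-2 i = cong proj₁ (proj₂ (proj₂ (state-suc i)))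

      vertex-3 : ∀ i → vertex (2 ℕ.+ i) ≡ proj₂ (proj₂ (state (position i)))
      vertex-3 i = trans (vertex-2 (1 ℕ.+ i)) (cong (proj₁ ∘ proj₂) (proj₂ (proj₂ (state-suc i))))

      vertex-4 : ∀ i → vertex (3 ℕ.+ i) ≡ proj₁ (state-suc i)
      vertex-4 i = trans (vertex-3 (1 ℕ.+ i)) (cong (proj₂ ∘ proj₂) (proj₂ (proj₂ (state-suc i))))

      vertex-edge : ∀ i → E (vertex i) (vertex (1 ℕ.+ i)) (vertex (2 ℕ.+ i)) (vertex (3 ℕ.+ i))
      vertex-edge i rewrite vertex-4 i | vertex-3 i | vertex-2 i = proj₁ (proj₂ (state-suc i))

      vertex-periodic : ∀ i → vertex (suc k ℕ.+ i) ≡ vertex i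
      vertex-periodic i = cong (proj₁ ∘ state)
        (trans (iterate-+ (suc k) i _) (cong (iterate i) (iterate-return k s w₀)))

    closed-walk⇒periodic : Σ[ v ∈ (ℕ → A) ]
      (∀ i → E (v i) (v (1 ℕ.+ i)) (v (2 ℕ.+ i)) (v (3 ℕ.+ i))) × (∀ i → v (suc k ℕ.+ i) ≡ v i)
    closed-walk⇒periodic = vertex , vertex-edge , vertex-periodic

-- Ordered edges of a 4-graph

quad : ∀ {n} → Fin n → Fin n → Fin n → Fin n → Subset n
quad a b c d = ⁅ a ⁆ ∪ (⁅ b ⁆ ∪ (⁅ c ⁆ ∪ ⁅ d ⁆))

∪-swap : ∀ {n} (p q r : Subset n) → p ∪ (q ∪ r) ≡ q ∪ (p ∪ r)
∪-swap p q r = trans (sym (∪-assoc p q r)) (trans (cong (_∪ r) (∪-comm p q)) (∪-assoc q p r))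

∣p∪q∣≤ : ∀ {n} (p q : Subset n) → ∣ p ∪ q ∣ ℕ.≤ ∣ p ∣ ℕ.+ ∣ q ∣
∣p∪q∣≤ []            []            = ℕ.z≤n
∣p∪q∣≤ (inside  ∷ p) (inside  ∷ q) = ℕ.s≤s (ℕ.≤-trans (∣p∪q∣≤ p q) (ℕ.+-monoʳ-≤ ∣ p ∣ (ℕ.n≤1+n ∣ q ∣)))
∣p∪q∣≤ (inside  ∷ p) (outside ∷ q) = ℕ.s≤s (∣p∪q∣≤ p q)
∣p∪q∣≤ (outside ∷ p) (inside  ∷ q) = ℕ.≤-trans (ℕ.s≤s (∣p∪q∣≤ p q)) (ℕ.≤-reflexive (sym (ℕ.+-suc ∣ p ∣ ∣ q ∣)))
∣p∪q∣≤ (outside ∷ p) (outside ∷ q) = ∣p∪q∣≤ p q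

-- By idempotence of union a repeated vertex leaves only three singletons.
∣quad∣≢4 : ∀ {n} (a b c : Fin n) → ∣ quad a a b c ∣ ≢ 4
∣quad∣≢4 a b c eq = ℕ.<⇒≱ {3} {4} ℕ.≤-refl (begin
  4                                      ≡⟨ eq ⟨
  ∣ quad a a b c ∣                       ≡⟨ cong ∣_∣ (trans (sym (∪-assoc ⁅ a ⁆ ⁅ a ⁆ (⁅ b ⁆ ∪ ⁅ c ⁆))) (cong (_∪ (⁅ b ⁆ ∪ ⁅ c ⁆)) (∪-idem ⁅ a ⁆))) ⟩
  ∣ ⁅ a ⁆ ∪ (⁅ b ⁆ ∪ ⁅ c ⁆) ∣            ≤⟨ ∣p∪q∣≤ ⁅ a ⁆ _ ⟩
  ∣ ⁅ a ⁆ ∣ ℕ.+ ∣ ⁅ b ⁆ ∪ ⁅ c ⁆ ∣        ≤⟨ ℕ.+-monoʳ-≤ ∣ ⁅ a ⁆ ∣ (∣p∪q∣≤ ⁅ b ⁆ ⁅ c ⁆) ⟩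
  ∣ ⁅ a ⁆ ∣ ℕ.+ (∣ ⁅ b ⁆ ∣ ℕ.+ ∣ ⁅ c ⁆ ∣)  ≡⟨ cong₂ ℕ._+_ (∣⁅x⁆∣≡1 a) (cong₂ ℕ._+_ (∣⁅x⁆∣≡1 b) (∣⁅x⁆∣≡1 c)) ⟩
  3                                      ∎)
  where open ℕ.≤-Reasoning

∈quad⁻ : ∀ {n} {x a b c d : Fin n} → x ∈ quad a b c d → x ≡ a ⊎ x ≡ b ⊎ x ≡ c ⊎ x ≡ d
∈quad⁻ {a = a} {b} {c} {d} x∈ with x∈p∪q⁻ ⁅ a ⁆ _ x∈
... | inj₁ x∈a = inj₁ (x∈⁅y⁆⇒x≡y a x∈a)
... | inj₂ x∈ with x∈p∪q⁻ ⁅ b ⁆ _ x∈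
...   | inj₁ x∈b = inj₂ (inj₁ (x∈⁅y⁆⇒x≡y b x∈b))
...   | inj₂ x∈ with x∈p∪q⁻ ⁅ c ⁆ _ x∈
...     | inj₁ x∈c = inj₂ (inj₂ (inj₁ (x∈⁅y⁆⇒x≡y c x∈c)))
...     | inj₂ x∈d = inj₂ (inj₂ (inj₂ (x∈⁅y⁆⇒x≡y d x∈d)))

∈quad⁺ : ∀ {n} {x a b c d : Fin n} → x ≡ a ⊎ x ≡ b ⊎ x ≡ c ⊎ x ≡ d → x ∈ quad a b c d
∈quad⁺ (inj₁ refl)               = x∈p∪q⁺ (inj₁ (x∈⁅x⁆ _))
∈quad⁺ (inj₂ (inj₁ refl))        = x∈p∪q⁺ (inj₂ (x∈p∪q⁺ (inj₁ (x∈⁅x⁆ _))))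
∈quad⁺ (inj₂ (inj₂ (inj₁ refl))) = x∈p∪q⁺ (inj₂ (x∈p∪q⁺ (inj₂ (x∈p∪q⁺ (inj₁ (x∈⁅x⁆ _))))))
∈quad⁺ (inj₂ (inj₂ (inj₂ refl))) = x∈p∪q⁺ (inj₂ (x∈p∪q⁺ (inj₂ (x∈p∪q⁺ (inj₂ (x∈⁅x⁆ _))))))

mapsOnto-quad : ∀ {m n} (f : Fin m → Fin n) a b c d → MapsOnto f (quad a b c d) (quad (f a) (f b) (f c) (f d))
mapsOnto-quad f a b c d y = mk⇔ to from
  where
  to : y ∈ quad (f a) (f b) (f c) (f d) → ∃[ x ] x ∈ quad a b c d × f x ≡ y
  to y∈ with ∈quad⁻ y∈
  ... | inj₁ refl               = a , ∈quad⁺ (inj₁ refl) , refl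
  ... | inj₂ (inj₁ refl)        = b , ∈quad⁺ (inj₂ (inj₁ refl)) , refl
  ... | inj₂ (inj₂ (inj₁ refl)) = c , ∈quad⁺ (inj₂ (inj₂ (inj₁ refl))) , refl
  ... | inj₂ (inj₂ (inj₂ refl)) = d , ∈quad⁺ (inj₂ (inj₂ (inj₂ refl))) , refl
  from : ∃[ x ] x ∈ quad a b c d × f x ≡ y → y ∈ quad (f a) (f b) (f c) (f d)
  from (x , x∈ , refl) with ∈quad⁻ x∈
  ... | inj₁ refl               = ∈quad⁺ (inj₁ refl)
  ... | inj₂ (inj₁ refl)        = ∈quad⁺ (inj₂ (inj₁ refl))
  ... | inj₂ (inj₂ (inj₁ refl)) = ∈quad⁺ (inj₂ (inj₂ (inj₁ refl)))
  ... | inj₂ (inj₂ (inj₂ refl)) = ∈quad⁺ (inj₂ (inj₂ (inj₂ refl)))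

_≟ˢ_ : ∀ {n} → DecidableEquality (Subset n)
_≟ˢ_ = Vec.≡-dec Bool._≟_

infixl 5 _∖_
_∖_ : ∀ {n} → Subset n → Fin n → Subset n
p ∖ a = p [ a ]≔ outside

∣∖∣ : ∀ {n} (p : Subset n) a → lookup p a ≡ true → ∣ p ∣ ≡ suc ∣ p ∖ a ∣
∣∖∣ (inside  ∷ p) zero    _  = refl
∣∖∣ (inside  ∷ p) (suc a) pa = cong suc (∣∖∣ p a pa)
∣∖∣ (outside ∷ p) (suc a) pa = ∣∖∣ p a pa

⁅⁆∪∖ : ∀ {n} (p : Subset n) a → lookup p a ≡ true → ⁅ a ⁆ ∪ (p ∖ a) ≡ p
⁅⁆∪∖ (inside ∷ p) zero    _  = cong (inside ∷_) (∪-identityˡ p)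
⁅⁆∪∖ (x ∷ p)      (suc a) pa = cong (x ∷_) (⁅⁆∪∖ p a pa)

∣p∣≡0⇒p≡⊥ : ∀ {n} (p : Subset n) → ∣ p ∣ ≡ 0 → p ≡ ⊥
∣p∣≡0⇒p≡⊥ []            _  = refl
∣p∣≡0⇒p≡⊥ (outside ∷ p) ∣p∣ = cong (outside ∷_) (∣p∣≡0⇒p≡⊥ p ∣p∣)

-- Stated for a general `tabulate f`, because the recursion from `allFin` passes to `f ∘ suc`.
∑-lookup : ∀ {n} {A : Set} (p : Subset n) (f : Fin n → A) (g : A → ℤ) c →
  (∀ i → g (f i) ≡ 𝟙 (lookup p i) * c) → ∑ (tabulate f) g ≡ + ∣ p ∣ * c
∑-lookup []            f g c eq = sym (*-zeroˡ c)
∑-lookup (inside ∷ p)  f g c eq = trans (cong₂ _+_ (eq zero) (∑-lookup p (f ∘ suc) g c (eq ∘ suc)))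
  (sym (*-distribʳ-+ c 1ℤ (+ ∣ p ∣)))
∑-lookup (outside ∷ p) f g c eq = trans (cong₂ _+_ (trans (eq zero) (*-zeroˡ c)) (∑-lookup p (f ∘ suc) g c (eq ∘ suc)))
  (+-identityˡ _)

∑-choose : ∀ {n} (p : Subset n) (g : Fin n → ℤ) c → (∀ a → lookup p a ≡ true → g a ≡ c) →
  ∑ (allFin n) (λ a → 𝟙 (lookup p a) * g a) ≡ + ∣ p ∣ * c
∑-choose p g c eq = ∑-lookup p id _ c λ a → pointwise a (lookup p a) refl
  where
  pointwise : ∀ a b → lookup p a ≡ b → 𝟙 b * g a ≡ 𝟙 b * c
  pointwise a true  pa = cong (1ℤ *_) (eq a pa)
  pointwise a false _  = refl

module _ {n : ℕ} where

  private
    V = allFin n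

  -- Indicator that abcd lists p, as four successive choices without replacement. The sums then
  -- factor one at a time, giving 4 · 3 · 2 · 1.
  orderings : Subset n → Fin n → Fin n → Fin n → Fin n → ℤ
  orderings p a b c d = 𝟙 (lookup p a) * (𝟙 (lookup (p ∖ a) b) *
    (𝟙 (lookup (p ∖ a ∖ b) c) * (𝟙 (lookup (p ∖ a ∖ b ∖ c) d) * 1ℤ)))

  -- Each successful choice lowers the size by one, so after four nothing is left and p is the union
  -- of the chosen singletons.
  orderings-≤ : ∀ p → ∣ p ∣ ≡ 4 → ∀ a b c d → orderings p a b c d ≤ 𝟙 (does (quad a b c d ≟ˢ p))
  orderings-≤ p ∣p∣ a b c d with lookup p a in pa
  ... | false = 0≤𝟙 (does (quad a b c d ≟ˢ p))
  ... | true with lookup (p ∖ a) b in pb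
  ...   | false = 0≤𝟙 (does (quad a b c d ≟ˢ p))
  ...   | true with lookup (p ∖ a ∖ b) c in pc
  ...     | false = 0≤𝟙 (does (quad a b c d ≟ˢ p))
  ...     | true with lookup (p ∖ a ∖ b ∖ c) d in pd
  ...       | false = 0≤𝟙 (does (quad a b c d ≟ˢ p))
  ...       | true = ≤-reflexive (sym (cong 𝟙 (dec-true (quad a b c d ≟ˢ p) quad≡p)))
    where
    p₁ = p ∖ a
    p₂ = p₁ ∖ b
    p₃ = p₂ ∖ c
    p₄ = p₃ ∖ d
    empty : p₄ ≡ ⊥
    empty = ∣p∣≡0⇒p≡⊥ p₄ (ℕ.suc-injective (ℕ.suc-injective (ℕ.suc-injective (ℕ.suc-injective (begin
      suc (suc (suc (suc ∣ p₄ ∣)))  ≡⟨ cong (3 ℕ.+_) (∣∖∣ p₃ d pd) ⟨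
      suc (suc (suc ∣ p₃ ∣))        ≡⟨ cong (2 ℕ.+_) (∣∖∣ p₂ c pc) ⟨
      suc (suc ∣ p₂ ∣)              ≡⟨ cong (1 ℕ.+_) (∣∖∣ p₁ b pb) ⟨
      suc ∣ p₁ ∣                    ≡⟨ ∣∖∣ p a pa ⟨
      ∣ p ∣                         ≡⟨ ∣p∣ ⟩
      4                             ∎)))))
      where open ≡-Reasoning
    quad≡p : quad a b c d ≡ p
    quad≡p = begin
      quad a b c d                             ≡⟨ cong (λ q → ⁅ a ⁆ ∪ (⁅ b ⁆ ∪ (⁅ c ⁆ ∪ q))) (trans (cong (⁅ d ⁆ ∪_) empty) (∪-identityʳ _)) ⟨
      ⁅ a ⁆ ∪ (⁅ b ⁆ ∪ (⁅ c ⁆ ∪ (⁅ d ⁆ ∪ p₄)))  ≡⟨ cong (λ q → ⁅ a ⁆ ∪ (⁅ b ⁆ ∪ (⁅ c ⁆ ∪ q))) (⁅⁆∪∖ p₃ d pd) ⟩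
      ⁅ a ⁆ ∪ (⁅ b ⁆ ∪ (⁅ c ⁆ ∪ p₃))           ≡⟨ cong (λ q → ⁅ a ⁆ ∪ (⁅ b ⁆ ∪ q)) (⁅⁆∪∖ p₂ c pc) ⟩
      ⁅ a ⁆ ∪ (⁅ b ⁆ ∪ p₂)                     ≡⟨ cong (⁅ a ⁆ ∪_) (⁅⁆∪∖ p₁ b pb) ⟩
      ⁅ a ⁆ ∪ p₁                               ≡⟨ ⁅⁆∪∖ p a pa ⟩
      p                                        ∎
      where open ≡-Reasoning

  private
    ∣∖∣-pred : ∀ (p : Subset n) a {k} → ∣ p ∣ ≡ suc k → lookup p a ≡ true → ∣ p ∖ a ∣ ≡ k
    ∣∖∣-pred p a ∣p∣ pa = ℕ.suc-injective (trans (sym (∣∖∣ p a pa)) ∣p∣)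

    choose : ∀ (p : Subset n) {k} (g : Fin n → ℤ) c → ∣ p ∣ ≡ k → (∀ a → lookup p a ≡ true → g a ≡ c) →
      ∑ V (λ a → 𝟙 (lookup p a) * g a) ≡ + k * c
    choose p g c ∣p∣ eq = trans (∑-choose p g c eq) (cong (λ k → + k * c) ∣p∣)

    ∑-orderings₁ : ∀ p → ∣ p ∣ ≡ 1 → ∑ V (λ a → 𝟙 (lookup p a) * 1ℤ) ≡ + 1
    ∑-orderings₁ p ∣p∣ = choose p _ 1ℤ ∣p∣ λ _ _ → refl

    ∑-orderings₂ : ∀ p → ∣ p ∣ ≡ 2 → ∑₂ V (λ a b → 𝟙 (lookup p a) * (𝟙 (lookup (p ∖ a) b) * 1ℤ)) ≡ + 2
    ∑-orderings₂ p ∣p∣ = trans (∑-cong V λ a → ∑-*ˡ V (𝟙 (lookup p a)) _)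
      (choose p _ (+ 1) ∣p∣ λ a pa → ∑-orderings₁ (p ∖ a) (∣∖∣-pred p a ∣p∣ pa))

    ∑-orderings₃ : ∀ p → ∣ p ∣ ≡ 3 →
      ∑₃ V (λ a b c → 𝟙 (lookup p a) * (𝟙 (lookup (p ∖ a) b) * (𝟙 (lookup (p ∖ a ∖ b) c) * 1ℤ))) ≡ + 6
    ∑-orderings₃ p ∣p∣ = trans (∑-cong V λ a → ∑₂-*ˡ V (𝟙 (lookup p a)) _)
      (choose p _ (+ 2) ∣p∣ λ a pa → ∑-orderings₂ (p ∖ a) (∣∖∣-pred p a ∣p∣ pa))

  ∑-orderings : ∀ p → ∣ p ∣ ≡ 4 → ∑₄ V (orderings p) ≡ + 24
  ∑-orderings p ∣p∣ = trans (∑-cong V λ a → ∑₃-*ˡ V (𝟙 (lookup p a)) _)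
    (choose p _ (+ 6) ∣p∣ λ a pa → ∑-orderings₃ (p ∖ a) (∣∖∣-pred p a ∣p∣ pa))

  open DecMembership (_≟ˢ_ {n}) using (_∈?_)

  -- The list is free of repetitions, so `s` equals at most one of its members.
  ∑-multiplicity : ∀ s ps → Unique ps → ∑ ps (λ p → 𝟙 (does (s ≟ˢ p))) ≤ 𝟙 (does (s ∈? ps))
  ∑-multiplicity s []       _          = ≤-refl
  ∑-multiplicity s (p ∷ ps) (p∉ps ∷ u) with s ≟ˢ p
  ... | no _     = ≤-trans (≤-reflexive (+-identityˡ _)) (∑-multiplicity s ps u)
  ... | yes refl = ≤-reflexive (cong (λ k → 1ℤ + k) (none-left ps p∉ps))
    where
    none-left : ∀ ps → All (s ≢_) ps → ∑ ps (λ p → 𝟙 (does (s ≟ˢ p))) ≡ 0ℤ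
    none-left []       []          = refl
    none-left (p ∷ ps) (s≢p ∷ all) = cong₂ _+_ (cong 𝟙 (dec-false (s ≟ˢ p) s≢p)) (none-left ps all)

  -- Double counting: each edge contributes its 24 orderings.
  ∑-edges : ∀ ps → All (λ p → ∣ p ∣ ≡ 4) ps →
    + 24 * + length ps ≤ ∑₄ V (λ a b c d → ∑ ps (λ p → 𝟙 (does (quad a b c d ≟ˢ p))))
  ∑-edges []       []          = ∑-nonneg V λ a → ∑-nonneg V λ b → ∑-nonneg V λ c → ∑-nonneg V λ d → ≤-refl
  ∑-edges (p ∷ ps) (∣p∣ ∷ all) = begin
    + 24 * (1ℤ + + length ps)
      ≡⟨ *-distribˡ-+ (+ 24) 1ℤ (+ length ps) ⟩
    + 24 + + 24 * + length ps
      ≤⟨ +-mono-≤ (≤-reflexive (sym (∑-orderings p ∣p∣))) (∑-edges ps all) ⟩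
    ∑₄ V (orderings p) + ∑₄ V rest
      ≤⟨ +-monoˡ-≤ (∑₄ V rest) (∑-mono V λ a → ∑₃-mono V (orderings-≤ p ∣p∣ a)) ⟩
    ∑₄ V (λ a b c d → 𝟙 (does (quad a b c d ≟ˢ p))) + ∑₄ V rest
      ≡⟨ trans (∑-cong V λ a → ∑₃-+ V _ _) (∑-+ V _ _) ⟨
    ∑₄ V (λ a b c d → 𝟙 (does (quad a b c d ≟ˢ p)) + rest a b c d) ∎
    where
    open ≤-Reasoning
    rest : Fin n → Fin n → Fin n → Fin n → ℤ
    rest a b c d = ∑ ps (λ p → 𝟙 (does (quad a b c d ≟ˢ p)))

  -- From hom-freeness to the colouring and the edge bound

  module _ (G : 4-Graph n) where
    open UniformHypergraph G using (edges; unique; uniform)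

    edge? : Fin n → Fin n → Fin n → Fin n → Bool
    edge? a b c d = does (quad a b c d ∈? edges)

    24e≤∑ : + 24 * + e G ≤ ∑₄ V (λ a b c d → 𝟙 (edge? a b c d))
    24e≤∑ = ≤-trans (∑-edges edges uniform)
      (∑-mono V λ a → ∑₃-mono V λ b c d → ∑-multiplicity (quad a b c d) edges unique)

    edge?-irrefl : ∀ a b c → edge? a a b c ≡ false
    edge?-irrefl a b c = dec-false (quad a a b c ∈? edges) λ q∈ → ∣quad∣≢4 a b c (All.lookup uniform q∈)

    edge?-swap₁₂ : ∀ a b c d → edge? b a c d ≡ edge? a b c d
    edge?-swap₁₂ a b c d = cong (λ q → does (q ∈? edges)) (∪-swap ⁅ b ⁆ ⁅ a ⁆ (⁅ c ⁆ ∪ ⁅ d ⁆))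

    edge?-swap₂₃ : ∀ a b c d → edge? a c b d ≡ edge? a b c d
    edge?-swap₂₃ a b c d = cong (λ q → does ((⁅ a ⁆ ∪ q) ∈? edges)) (∪-swap ⁅ c ⁆ ⁅ b ⁆ ⁅ d ⁆)

    edge?-swap₃₄ : ∀ a b c d → edge? a b d c ≡ edge? a b c d
    edge?-swap₃₄ a b c d = cong (λ q → does ((⁅ a ⁆ ∪ (⁅ b ⁆ ∪ q)) ∈? edges)) (∪-comm ⁅ d ⁆ ⁅ c ⁆)

    Edge : Fin n → Fin n → Fin n → Fin n → Set
    Edge a b c d = edge? a b c d ≡ true

    rotate : ∀ {a b c d} → Edge a b c d → Edge b c d a
    rotate {a} {b} {c} {d} = trans (trans (edge?-swap₃₄ b c a d) (trans (edge?-swap₂₃ b a c d) (edge?-swap₁₂ a b c d)))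

    Edge⇒∈ : ∀ {a b c d} → Edge a b c d → quad a b c d List.∈ edges
    Edge⇒∈ {a} {b} {c} {d} eq with quad a b c d ∈? edges
    ... | yes q∈ = q∈

    module _ (v : ℕ → Fin n) {m : ℕ} (v-edge : ∀ i → Edge (v i) (v (1 ℕ.+ i)) (v (2 ℕ.+ i)) (v (3 ℕ.+ i)))
      (v-periodic : ∀ i → v (m ℕ.+ i) ≡ v i) where

      periodic-* : ∀ k i → v (k ℕ.* m ℕ.+ i) ≡ v i
      periodic-* zero    i = refl
      periodic-* (suc k) i = trans (cong v (ℕ.+-assoc m (k ℕ.* m) i)) (trans (v-periodic (k ℕ.* m ℕ.+ i)) (periodic-* k i))

      -- The cycle is wound k times around the period m; reducing an index mod ℓ does not change its
      -- vertex, since m divides ℓ.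
      periodic⇒homomorphism : ∀ k (4<ℓ : 4 ℕ.< k ℕ.* m) → Homomorphism (tightCycle (k ℕ.* m) 4<ℓ) G
      periodic⇒homomorphism k 4<ℓ = f , hom
        where
        ℓ = k ℕ.* m
        instance
          ℓ≢0 : NonZero ℓ
          ℓ≢0 = ℕ.>-nonZero (ℕ.≤-<-trans ℕ.z≤n 4<ℓ)
        f : Fin ℓ → Fin n
        f i = v (toℕ i)
        v-% : ∀ i → v (i ℕ.% ℓ) ≡ v i
        v-% i = begin
          v (i ℕ.% ℓ)                          ≡⟨ periodic-* (i ℕ./ ℓ ℕ.* k) (i ℕ.% ℓ) ⟨
          v (i ℕ./ ℓ ℕ.* k ℕ.* m ℕ.+ i ℕ.% ℓ)    ≡⟨ cong (λ j → v (j ℕ.+ i ℕ.% ℓ)) (ℕ.*-assoc (i ℕ./ ℓ) k m) ⟩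
          v (i ℕ./ ℓ ℕ.* ℓ ℕ.+ i ℕ.% ℓ)          ≡⟨ cong v (trans (ℕ.+-comm (i ℕ./ ℓ ℕ.* ℓ) (i ℕ.% ℓ)) (sym (m≡m%n+[m/n]*n i ℓ))) ⟩
          v i                                ∎
          where open ≡-Reasoning
        f-shift : ∀ i a → f (shift i a) ≡ v (a ℕ.+ toℕ i)
        f-shift i a = trans (cong v (Fin.toℕ-fromℕ< (m%n<n (toℕ i ℕ.+ a) ℓ)))
          (trans (v-% (toℕ i ℕ.+ a)) (cong v (ℕ.+-comm (toℕ i) a)))
        hom : IsHomomorphism (tightCycle ℓ 4<ℓ) G f
        hom p p∈ with ∈-map⁻ window (∈-deduplicate⁻ _ _ p∈)
        -- `window i` is by definition the `quad` of the four shifts.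
        ... | i , _ , refl = _ , Edge⇒∈ edge , mapsOnto-quad f (shift i 0) (shift i 1) (shift i 2) (shift i 3)
          where
          edge : Edge (f (shift i 0)) (f (shift i 1)) (f (shift i 2)) (f (shift i 3))
          edge rewrite f-shift i 0 | f-shift i 1 | f-shift i 2 | f-shift i 3 = v-edge (toℕ i)

    open TightWalk Edge rotate

    module _ (hom-free : 𝒞₁-HomFree G) where

      -- An odd closed walk of length m, traversed m + 4 times, has length ≡ 1 (mod 4).
      no-odd-closed-walk : ∀ {s} → ¬ ParityWalk true s s
      no-odd-closed-walk (suc k , odd-m , w) with closed-walk⇒periodic w | odd⇒1+2* (suc k) odd-m
      ... | v , v-edge , v-periodic | j , 1+k≡1+j*2 = hom-free ((suc k ℕ.+ 4) ℕ.* suc k) long mod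
        (periodic⇒homomorphism v v-edge v-periodic (suc k ℕ.+ 4) long)
        where
        -- The added 4 makes the length exceed 4 even for m = 1.
        long : 4 ℕ.< (suc k ℕ.+ 4) ℕ.* suc k
        long = ℕ.≤-trans (ℕ.+-monoˡ-≤ 4 (ℕ.s≤s (ℕ.z≤n {k}))) (ℕ.m≤m*n (suc k ℕ.+ 4) (suc k))
        -- With m = 2j + 1 the length is m(m + 4) = (m + 2)² - 4, an odd square less 4.
        expand : ∀ j → (1 ℕ.+ j ℕ.* 2 ℕ.+ 4) ℕ.* (1 ℕ.+ j ℕ.* 2) ≡ 1 ℕ.+ (j ℕ.* j ℕ.+ 3 ℕ.* j ℕ.+ 1) ℕ.* 4
        expand = ℕ-Solver.solve-∀
        mod : (suc k ℕ.+ 4) ℕ.* suc k ℕ.% 4 ≡ 1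
        mod = trans (cong (λ m → (m ℕ.+ 4) ℕ.* m ℕ.% 4) 1+k≡1+j*2)
          (trans (cong (ℕ._% 4) (expand j)) ([m+kn]%n≡m%n 1 (j ℕ.* j ℕ.+ 3 ℕ.* j ℕ.+ 1) 4))

      private
        Quadruple : Set
        Quadruple = Fin n × Fin n × Fin n × Fin n

        move : Quadruple → State × State
        move (a , b , c , d) = (a , b , c) , (b , c , d)

        EdgeAt : Quadruple → Set
        EdgeAt (a , b , c , d) = Edge a b c d

        edgeAt? : ∀ q → Dec (EdgeAt q)
        edgeAt? (a , b , c , d) = edge? a b c d Bool.≟ true

        moves : List Quadruple
        moves = filter edgeAt? (cartesianProduct V (cartesianProduct V (cartesianProduct V V)))

        odd-move : ∀ {st} → st List.∈ map move moves → ParityWalk true (proj₁ st) (proj₂ st)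
        odd-move st∈ with ∈-map⁻ move st∈
        ... | _ , q∈ , refl = 1 , refl , step (proj₂ (∈-filter⁻ edgeAt? {xs = cartesianProduct V (cartesianProduct V (cartesianProduct V V))} q∈)) stop

      -- The states are ordered triples, and the pairs to be coloured differently are the tight
      -- steps, one for each ordered edge.
      triple-colouring : Σ[ col ∈ (Fin n → Fin n → Fin n → Bool) ]
        (∀ a b c d → Edge a b c d → col b c d ≡ not (col a b c))
      triple-colouring with two-colouring (≡-dec Fin._≟_ (≡-dec Fin._≟_ Fin._≟_)) ParityWalk
        (0 , refl , stop) parity-sym parity-trans no-odd-closed-walk (map move moves) (All.tabulate odd-move)
      ... | col , proper = (λ a b c → col (a , b , c)) , λ a b c d ed →
        All.lookup proper (∈-map⁺ move (∈-filter⁺ edgeAt? (∈-cartesianProduct⁺ (∈-allFin a)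
          (∈-cartesianProduct⁺ (∈-allFin b) (∈-cartesianProduct⁺ (∈-allFin c) (∈-allFin d)))) ed))

      48e+n≤n⁴ : + 48 * + e G + + n ≤ + n * + n * + n * + n
      48e+n≤n⁴ = ≤-trans
        (+-monoˡ-≤ (+ n) (≤-trans (≤-reflexive (*-assoc (+ 2) (+ 24) (+ e G))) (*-monoˡ-≤-nonNeg (+ 2) 24e≤∑)))
        (edge-bound Fin._≟_ edge? edge?-irrefl edge?-swap₁₂ edge?-swap₂₃ edge?-swap₃₄
          (proj₁ triple-colouring) (proj₂ triple-colouring) n V (length-tabulate id))

theorem5p7 : ∀ (n : ℕ) → n ≥ 1 → (G : 4-Graph n) → 𝒞₁-HomFree G →
    (+ (e G)) / 1 < (+ (n ^ 4)) / 48
theorem5p7 n n≥1 G hom-free = *<* (begin-strict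
  + e G * + 48               ≡⟨ *-comm (+ e G) (+ 48) ⟩
  + 48 * + e G               ≡⟨ +-identityʳ _ ⟨
  -- Strictness comes from the summand n ≥ 1 carried through the induction.
  + 48 * + e G + 0ℤ          <⟨ +-monoʳ-< (+ 48 * + e G) (+<+ n≥1) ⟩
  + 48 * + e G + + n         ≤⟨ 48e+n≤n⁴ G hom-free ⟩
  + n * + n * + n * + n      ≡⟨ fourth-power ⟨
  + (n ^ 4) * 1ℤ             ∎)
  where
  open ≤-Reasoning
  associate : ∀ i → i * (i * (i * (i * 1ℤ))) * 1ℤ ≡ i * i * i * i
  associate = solve-∀
  fourth-power : + (n ^ 4) * 1ℤ ≡ + n * + n * + n * + n
  fourth-power = trans (cong (_* 1ℤ) (trans (pos-* n (n ^ 3)) (cong (+ n *_) (trans (pos-* n (n ^ 2)) (cong (+ n *_)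
    (trans (pos-* n (n ^ 1)) (cong (+ n *_) (pos-* n 1)))))))) (associate (+ n))
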